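{- Let $q\ge2$, and let $t,n$ be positive integers with $t\ge3$ and $3\le n<\frac{15+\sqrt{33}}{24}(t-1)^2$. A code $\mathcal C\subseteq Q^n$ is a wide-sense $t$-frameproof code of size $n$ if and only if its representation matrix in standard form is a permutation matrix of degree $n$.
   Context: Let $Q=\{0,1,\dots,q-1\}$. For a nonempty set $X=\{\mathbf c^1,\dots,\mathbf c^s\}\subseteq Q^n$, a position $i\in[n]$ is undetectable for $X$ if $c^1_i=\dots=c^s_i$; let $U(X)$ be the set of undetectable positions and $\mathrm{wdesc}(X)=\{\mathbf y\in Q^n: y_i=c^1_i \text{ for all } i\in U(X)\}$. For $t\ge2$, a code $\mathcal C\subseteq Q^n$ is a wide-sense $t$-frameproof code if $\mathrm{wdesc}(X)\cap\mathcal C=X$ for every nonempty $X\subseteq\mathcal C$ with $|X|\le t$. The representation matrix of $\mathcal C$ is the $n\times|\mathcal C|$ matrix over $Q$ whose columns are the codewords of $\mathcal C$. Permuting the symbols $0,\dots,q-1$ separately within each row gives an equivalent code. For a row $r$ and $i\in Q$, let $\lambda_i(r)$ be the number of entries equal to $i$ in row $r$; the representation matrix is in standard form if $\lambda_0(r)\ge\lambda_1(r)\ge\dots\ge\lambda_{q-1}(r)$ for every row $r$; "its representation matrix in standard form" means a matrix in standard form obtained from the representation matrix by such within-row symbol permutations. A permutation matrix of degree $n$ is an $n\times n$ $0/1$ matrix with exactly one $1$ in each row and each column. -}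

module Defs where

open import Data.Nat using (ℕ; _≤_; _*_; _^_; _∸_; _<_)
open import Data.Fin using (Fin; toℕ)
open import Data.Fin.Subset using (Subset; _∈_; Nonempty; ∣_∣)
open import Data.Fin.Permutation using (Permutation′; _⟨$⟩ʳ_)
open import Data.Fin.Properties using (_≟_)
open import Data.List using (List; length; filter)
open import Data.List.Base using (allFin)
open import Data.Product using (Σ; _×_; ∃)
open import Relation.Binary.PropositionalEquality using (_≡_)
open import Function.Bundles using (_⇔_)

Word : ℕ → ℕ → Set
Word q n = Fin n → Fin q

-- A code C ⊆ Q^n with |C| = m is given by an injective enumeration
-- C : Fin m → Word q n of its codewords (the columns of the representation matrix).

Undetectable : ∀ {q n m} → (Fin m → Word q n) → Subset m → Fin n → Set
Undetectable C X i = ∀ a b → a ∈ X → b ∈ X → C a i ≡ C b i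

InWdesc : ∀ {q n m} → (Fin m → Word q n) → Subset m → Word q n → Set
InWdesc C X y = ∀ i → Undetectable C X i → ∀ a → a ∈ X → y i ≡ C a i

WideSenseFP : ∀ {q n m} → ℕ → (Fin m → Word q n) → Set
WideSenseFP t C = ∀ X → Nonempty X → ∣ X ∣ ≤ t → ∀ j → (InWdesc C X (C j) ⇔ j ∈ X)

RepMatrix : ∀ {q n m} → (Fin m → Word q n) → Fin n → Fin m → Fin q
RepMatrix C r j = C j r

permuteRows : ∀ {q n m} → (Fin n → Permutation′ q) → (Fin n → Fin m → Fin q) → Fin n → Fin m → Fin q
permuteRows σ M r j = σ r ⟨$⟩ʳ M r j

rowCount : ∀ {q n m} → (Fin n → Fin m → Fin q) → Fin n → Fin q → ℕ
rowCount {m = m} M r i = length (filter (λ j → M r j ≟ i) (allFin m))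

StandardForm : ∀ {q n m} → (Fin n → Fin m → Fin q) → Set
StandardForm M = ∀ r i k → toℕ i ≤ toℕ k → rowCount M r k ≤ rowCount M r i

IsPermutationMatrix : ∀ {q n m} → (Fin n → Fin m → Fin q) → Set
IsPermutationMatrix {n = n} {m = m} M =
  (m ≡ n)
  × (∀ r j → toℕ (M r j) ≤ 1)
  × (∀ r → Σ (Fin m) λ j → toℕ (M r j) ≡ 1 × (∀ j′ → toℕ (M r j′) ≡ 1 → j′ ≡ j))
  × (∀ j → Σ (Fin n) λ r → toℕ (M r j) ≡ 1 × (∀ r′ → toℕ (M r′ j) ≡ 1 → r′ ≡ r))

StdFormIsPermMatrix : ∀ {q n m} → (Fin m → Word q n) → Set
StdFormIsPermMatrix {q} {n} C =
  Σ (Fin n → Permutation′ q) λ σ →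
    StandardForm (permuteRows σ (RepMatrix C)) × IsPermutationMatrix (permuteRows σ (RepMatrix C))

-- n < (15 + √33)/24 · (t-1)^2, stated exactly in ℕ (with s = (t-1)^2 > 0):
-- 24n < (15+√33)s  ⇔  (24n ∸ 15s)^2 < 33 s^2.
BoundHolds : ℕ → ℕ → Set
BoundHolds t n = (24 * n ∸ 15 * ((t ∸ 1) ^ 2)) ^ 2 < 33 * ((t ∸ 1) ^ 2) ^ 2

{-# OPTIONS --safe #-}
module Submission where

-- Fix a codeword c₀ and put d = t - 1. The sets of positions where the other codewords differ from
-- c₀ form a d-disjunct family of n - 1 blocks on n points. The claim is that in a d-disjunct family
-- on p < γ d² points, γ = (15 + √33)/24, either every block has a private point, or there are at
-- most p - 2 blocks; so here every codeword is singled out by a row, and counting rows finishes.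
--
-- For the claim (following Shangguan and Ge), discard the blocks with a private point together with
-- those points. Deleting a large block with all its points lowers d by one, so by induction on d all
-- blocks have size k with k d² + p < 2 d p. The pairs of points of a block B shared with another
-- block form a graph on B without a matching of size k - d, since otherwise d other blocks would
-- cover B. By the Erdős–Gallai bound on the size of such a graph, more than p ordered pairs belong
-- to B alone, and these sets of pairs are disjoint for different blocks.

open import Defs
open import Data.Bool using (if_then_else_)
open import Data.Nat hiding (_≟_)
open import Data.Nat.Properties hiding (_≟_; suc-injective)
open import Data.Nat.Induction using (<-wellFounded)
open import Data.Nat.Tactic.RingSolver using (solve-∀)
open import Data.Fin using (Fin; zero; suc; toℕ)
open import Data.Fin.Properties using (_≟_; suc-injective; toℕ-injective; any?; all?)
open import Data.Fin.Permutation using (Permutation′; _⟨$⟩ʳ_; _⟨$⟩ˡ_; _∘ₚ_; transpose; inverseˡ)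
open import Data.Fin.Subset using (Subset; inside; outside; ⁅_⁆; _∪_; ∣_∣) renaming (⊥ to ∅; _∈_ to _∈ₛ_)
open import Data.Fin.Subset.Properties using (x∈⁅x⁆; x∈⁅y⁆⇒x≡y; x∈p∪q⁺; x∈p∪q⁻; ∣⁅x⁆∣≡1; ∣⊥∣≡0; ∉⊥) renaming (_∈?_ to _∈ₛ?_)
open import Data.Vec using ([]; _∷_)
open import Data.List using (List; []; _∷_; _++_; length; filter; allFin; tabulate)
open import Data.List.Properties using (length-++)
open import Data.List.Membership.Propositional using (_∈_; _∉_; find)
open import Data.List.Membership.Propositional.Properties using (∈-filter⁺; ∈-allFin; ∈-∃++)
import Data.List.Membership.DecPropositional as DecMembership
open import Data.List.Relation.Unary.Any using (Any; here; there)
import Data.List.Relation.Unary.Any.Properties as Any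
open import Data.List.Relation.Unary.All as All using (All; []; _∷_)
import Data.List.Relation.Unary.All.Properties as All
open import Data.List.Relation.Unary.AllPairs using (AllPairs; []; _∷_)
open import Data.List.Relation.Unary.Unique.Propositional using (Unique)
import Data.List.Relation.Unary.Unique.Propositional.Properties as Unique
open import Data.List.Relation.Binary.Permutation.Propositional using (_↭_; ↭⇒↭ₛ)
open import Data.List.Relation.Binary.Permutation.Propositional.Properties using (All-resp-↭; shift; ↭-length)
import Data.List.Relation.Binary.Permutation.Setoid.Properties as Perm
open import Data.Product using (Σ; ∃; ∃₂; _×_; _,_; proj₁; proj₂; swap)
open import Data.Sum using (_⊎_; inj₁; inj₂)
open import Data.Empty using (⊥-elim)
open import Data.Unit using (⊤; tt)
open import Function using (_∘_; id)
open import Function.Definitions using (Injective)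
open import Function.Bundles using (_⇔_; mk⇔; Equivalence)
open import Induction.WellFounded using (Acc; acc)
open import Relation.Nullary using (Dec; yes; no; ¬_; does)
open import Relation.Nullary.Decidable using (_×-dec_; _⊎-dec_; _→-dec_; ¬?; decidable-stable)
open import Relation.Binary.PropositionalEquality
open import Algebra.Properties.Semiring.Sum +-*-semiring using (sum; sum-cong-≗; ∑-distrib-+; ∑-comm; *-distribˡ-sum; *-distribʳ-sum; sum-replicate-zero)

private variable
  n : ℕ
  A B : Set

-- The critical ratio

-- The inequality p < γ s with γ = (15 + √33)/24, squared. When 24p ≤ 15s the truncated difference
-- is 0 and only s > 0 is asserted.
Below : ℕ → ℕ → Set
Below p s = (24 * p ∸ 15 * s) ^ 2 < 33 * s ^ 2

-- `Below` bounds the ratio p / s, and the hypothesis is p′ / s′ ≤ p / s cross-multiplied. Truncated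
-- subtraction is monotone and products distribute over it, so the differences compare in the same
-- way.
below-scale : ∀ {p s p′ s′} → 0 < s′ → p′ * s ≤ p * s′ → Below p s → Below p′ s′
below-scale {p} {s} {p′} {s′} s′>0 le p<s =
  *-cancelʳ-< (s ^ 2) (e′ ^ 2) (33 * s′ ^ 2) (begin-strict
    e′ ^ 2 * s ^ 2         ≡⟨ e₁ e′ s ⟩
    (e′ * s) * (e′ * s)    ≤⟨ *-mono-≤ es es ⟩
    (e * s′) * (e * s′)    ≡⟨ e₁ e s′ ⟨
    e ^ 2 * s′ ^ 2         <⟨ *-monoˡ-< (s′ ^ 2) {{>-nonZero (*-mono-≤ s′>0 (*-mono-≤ s′>0 ≤-refl))}} p<s ⟩
    33 * s ^ 2 * s′ ^ 2    ≡⟨ e₂ s s′ ⟩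
    33 * s′ ^ 2 * s ^ 2    ∎)
  where
  open ≤-Reasoning
  e e′ : ℕ
  e = 24 * p ∸ 15 * s
  e′ = 24 * p′ ∸ 15 * s′
  e₁ : ∀ x y → (x * (x * 1)) * (y * (y * 1)) ≡ (x * y) * (x * y)
  e₁ = solve-∀
  e₂ : ∀ x y → 33 * (x * (x * 1)) * (y * (y * 1)) ≡ 33 * (y * (y * 1)) * (x * (x * 1))
  e₂ = solve-∀
  e₃ : ∀ x y → 15 * x * y ≡ 15 * y * x
  e₃ = solve-∀
  es : e′ * s ≤ e * s′
  es = begin
    e′ * s                          ≡⟨ *-distribʳ-∸ s (24 * p′) (15 * s′) ⟩
    24 * p′ * s ∸ 15 * s′ * s       ≡⟨ cong₂ _∸_ (*-assoc 24 p′ s) (e₃ s′ s) ⟩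
    24 * (p′ * s) ∸ 15 * s * s′     ≤⟨ ∸-monoˡ-≤ (15 * s * s′) (*-monoʳ-≤ 24 le) ⟩
    24 * (p * s′) ∸ 15 * s * s′     ≡⟨ cong (_∸ 15 * s * s′) (*-assoc 24 p s′) ⟨
    24 * p * s′ ∸ 15 * s * s′       ≡⟨ *-distribʳ-∸ s′ (24 * p) (15 * s) ⟨
    e * s′                          ∎

-- γ < 1: from p ≥ s the difference 24p - 15s would be at least 9s, and 81 > 33.
below⇒< : ∀ {p s} → Below p s → p < s
below⇒< {p} {s} h with p <? s
... | yes p<s = p<s
... | no p≮s = ⊥-elim (<-irrefl refl (begin-strict
    33 * s ^ 2                   ≤⟨ *-monoˡ-≤ (s ^ 2) (m≤m+n 33 48) ⟩
    81 * s ^ 2                   ≡⟨ e₁ s ⟩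
    (9 * s) ^ 2                  ≤⟨ ^-monoˡ-≤ 2 9s ⟩
    (24 * p ∸ 15 * s) ^ 2        <⟨ h ⟩
    33 * s ^ 2                   ∎))
  where
  open ≤-Reasoning
  e₁ : ∀ x → 81 * (x * (x * 1)) ≡ 9 * x * (9 * x * 1)
  e₁ = solve-∀
  e₂ : ∀ x → 9 * x + 15 * x ≡ 24 * x
  e₂ = solve-∀
  9s : 9 * s ≤ 24 * p ∸ 15 * s
  9s = m+n≤o⇒m≤o∸n (9 * s) (≤-trans (≤-reflexive (e₂ s)) (*-monoʳ-≤ 24 (≮⇒≥ p≮s)))

-- The critical constant enters only here: with 4p = 2s + α and 3α = β + 4s the
-- hypothesis Below p s becomes β² + 5sβ < 2s².
below-product : ∀ {p s α β y z} → Below p s → 4 * p ≡ 2 * s + α → 3 * α ≡ β + 4 * s →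
                y ≤ α → z ≤ β → 4 * p * s + y * z < 4 * (s * s)
below-product {p} {s} {α} {β} {y} {z} h pα αβ y≤α z≤β =
  *-cancelˡ-< 3 _ _ (begin-strict
    3 * (4 * p * s + y * z)           ≤⟨ *-monoʳ-≤ 3 (+-monoʳ-≤ (4 * p * s) (*-mono-≤ y≤α z≤β)) ⟩
    3 * (4 * p * s + α * β)           ≡⟨ cong (λ c → 3 * (c * s + α * β)) pα ⟩
    3 * ((2 * s + α) * s + α * β)     ≡⟨ e₁ s α β ⟩
    6 * (s * s) + 3 * α * (s + β)     ≡⟨ cong (λ c → 6 * (s * s) + c * (s + β)) αβ ⟩
    6 * (s * s) + (β + 4 * s) * (s + β) ≡⟨ e₂ s β ⟩
    (β * β + 5 * (s * β)) + 10 * (s * s)  <⟨ +-monoˡ-< (10 * (s * s)) quad ⟩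
    2 * (s * s) + 10 * (s * s)        ≡⟨ e₃ s ⟩
    3 * (4 * (s * s))                 ∎)
  where
  open ≤-Reasoning
  e₁ : ∀ s α β → 3 * ((2 * s + α) * s + α * β) ≡ 6 * (s * s) + 3 * α * (s + β)
  e₁ = solve-∀
  e₂ : ∀ s β → 6 * (s * s) + (β + 4 * s) * (s + β) ≡ (β * β + 5 * (s * β)) + 10 * (s * s)
  e₂ = solve-∀
  e₃ : ∀ s → 2 * (s * s) + 10 * (s * s) ≡ 3 * (4 * (s * s))
  e₃ = solve-∀
  e₄ : ∀ p → 24 * p ≡ 6 * (4 * p)
  e₄ = solve-∀
  e₅ : ∀ s α → 6 * (2 * s + α) ≡ 12 * s + 2 * (3 * α)
  e₅ = solve-∀
  e₆ : ∀ s β → 12 * s + 2 * (β + 4 * s) ≡ 15 * s + (2 * β + 5 * s)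
  e₆ = solve-∀
  e₇ : ∀ s β → 4 * (β * β + 5 * (s * β)) + 25 * (s * s) ≡ (2 * β + 5 * s) * ((2 * β + 5 * s) * 1)
  e₇ = solve-∀
  e₈ : ∀ s → 33 * (s * (s * 1)) ≡ 4 * (2 * (s * s)) + 25 * (s * s)
  e₈ = solve-∀
  excess : 24 * p ∸ 15 * s ≡ 2 * β + 5 * s
  excess = trans (cong (_∸ 15 * s) (begin-equality
    24 * p                        ≡⟨ e₄ p ⟩
    6 * (4 * p)                   ≡⟨ cong (6 *_) pα ⟩
    6 * (2 * s + α)               ≡⟨ e₅ s α ⟩
    12 * s + 2 * (3 * α)          ≡⟨ cong (λ c → 12 * s + 2 * c) αβ ⟩
    12 * s + 2 * (β + 4 * s)      ≡⟨ e₆ s β ⟩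
    15 * s + (2 * β + 5 * s)      ∎)) (m+n∸m≡n (15 * s) _)
  -- Completing the square: 24p - 15s is 2β + 5s, whose square is 4(β² + 5sβ) + 25s², while 33s² =
  -- 8s² + 25s².
  quad : β * β + 5 * (s * β) < 2 * (s * s)
  quad = *-cancelˡ-< 4 _ _ (+-cancelʳ-< (25 * (s * s)) _ _ (begin-strict
    4 * (β * β + 5 * (s * β)) + 25 * (s * s)  ≡⟨ e₇ s β ⟩
    (2 * β + 5 * s) ^ 2                       ≡⟨ cong (_^ 2) excess ⟨
    (24 * p ∸ 15 * s) ^ 2                     <⟨ h ⟩
    33 * s ^ 2                                ≡⟨ e₈ s ⟩
    4 * (2 * (s * s)) + 25 * (s * s)          ∎))

-- Here k is the size of a block, and b and b + w are the degrees at an edge of least degree sum in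
-- a subgraph of its graph of own pairs; the right side will be a lower bound for the number of
-- those pairs. With `v` = 2d - w ≤ 2b it suffices that 4p < v(v + 2 + 4w), to be compared with 4p <
-- 4d² = (w + v)².
below⇒own-pairs : ∀ {d p k b w} → Below p (d ^ 2) → k * d ^ 2 + p < 2 * d * p →
                  2 * d ≤ 2 * b + w → suc (b + w) ≤ k → p < b * (b + 1 + 2 * w)
below⇒own-pairs {d} {p} {k} {b} {w} h small edge size = *-cancelˡ-< 4 _ _ (begin-strict
    4 * p                             <⟨ main ⟩
    v * (v + 2 + 4 * w)               ≤⟨ *-mono-≤ v≤2b (+-monoˡ-≤ (4 * w) (+-monoˡ-≤ 2 v≤2b)) ⟩
    2 * b * (2 * b + 2 + 4 * w)       ≡⟨ f₁ b w ⟩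
    4 * (b * (b + 1 + 2 * w))         ∎)
  where
  open ≤-Reasoning
  s v : ℕ
  s = d ^ 2
  f₁ : ∀ b w → 2 * b * (2 * b + 2 + 4 * w) ≡ 4 * (b * (b + 1 + 2 * w))
  f₁ = solve-∀
  p<s : p < s
  p<s = below⇒< h
  f₂ : ∀ k d → k * d * d ≡ k * (d * (d * 1))
  f₂ = solve-∀
  f₃ : ∀ d p → 2 * d * p ≡ 2 * p * d
  f₃ = solve-∀
  kd<2p : k * d < 2 * p
  kd<2p = *-cancelʳ-< d (k * d) (2 * p) (begin-strict
    k * d * d         ≡⟨ f₂ k d ⟩
    k * s             ≤⟨ m≤m+n (k * s) p ⟩
    k * s + p         <⟨ small ⟩
    2 * d * p         ≡⟨ f₃ d p ⟩
    2 * p * d         ∎)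
  f₄ : ∀ b w → 2 * b + w + (w + 2) ≡ 2 * suc (b + w)
  f₄ = solve-∀
  w≤2k : 2 * d + (w + 2) ≤ 2 * k
  w≤2k = begin
    2 * d + (w + 2)       ≤⟨ +-monoˡ-≤ (w + 2) edge ⟩
    2 * b + w + (w + 2)   ≡⟨ f₄ b w ⟩
    2 * suc (b + w)       ≤⟨ *-monoʳ-≤ 2 size ⟩
    2 * k                 ∎
  f₅ : ∀ d w → 2 * (d * (d * 1)) + w * d + 2 * d ≡ (2 * d + (w + 2)) * d
  f₅ = solve-∀
  f₆ : ∀ p → 2 * (2 * p) ≡ 4 * p
  f₆ = solve-∀
  -- The two degree conditions give 2d + w + 2 ≤ 2k, and kd < 2p turns this into a bound on w.
  wd≤ : 2 * s + w * d + 2 * d ≤ 4 * p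
  wd≤ = begin
    2 * s + w * d + 2 * d   ≡⟨ f₅ d w ⟩
    (2 * d + (w + 2)) * d   ≤⟨ *-monoˡ-≤ d w≤2k ⟩
    2 * k * d               ≡⟨ *-assoc 2 k d ⟩
    2 * (k * d)             ≤⟨ *-monoʳ-≤ 2 (<⇒≤ kd<2p) ⟩
    2 * (2 * p)             ≡⟨ f₆ p ⟩
    4 * p                   ∎
  f₇ : ∀ d → 4 * (d * (d * 1)) ≡ 2 * d * (2 * d)
  f₇ = solve-∀
  w≤2d : w ≤ 2 * d
  w≤2d with w ≤? 2 * d
  ... | yes le = le
  ... | no nle = ⊥-elim (<-irrefl refl (begin-strict
    4 * p                   <⟨ *-monoʳ-< 4 p<s ⟩
    4 * s                   ≡⟨ f₈ d ⟩
    2 * s + 2 * d * d       ≤⟨ +-monoʳ-≤ (2 * s) (*-monoˡ-≤ d (≰⇒≥ nle)) ⟩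
    2 * s + w * d           ≤⟨ m≤m+n _ (2 * d) ⟩
    2 * s + w * d + 2 * d   ≤⟨ wd≤ ⟩
    4 * p                   ∎))
    where
    f₈ : ∀ d → 4 * (d * (d * 1)) ≡ 2 * (d * (d * 1)) + 2 * d * d
    f₈ = solve-∀
  v = 2 * d ∸ w
  w+v : w + v ≡ 2 * d
  w+v = m+[n∸m]≡n w≤2d
  v≤2b : v ≤ 2 * b
  v≤2b = m≤n+o⇒m∸n≤o (2 * d) w (≤-trans edge (≤-reflexive (+-comm (2 * b) w)))
  main : 4 * p < v * (v + 2 + 4 * w)
  main with ≤-total w (2 * v)
  -- For w ≤ 2v the square w² + v² + 2wv is at most v² + 4wv.
  ... | inj₁ w≤2v = begin-strict
    4 * p                             <⟨ *-monoʳ-< 4 p<s ⟩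
    4 * s                             ≡⟨ f₇ d ⟩
    2 * d * (2 * d)                   ≡⟨ cong₂ _*_ w+v w+v ⟨
    (w + v) * (w + v)                 ≡⟨ g₁ w v ⟩
    w * w + (v * v + 2 * (w * v))     ≤⟨ +-monoˡ-≤ _ (*-monoʳ-≤ w w≤2v) ⟩
    w * (2 * v) + (v * v + 2 * (w * v)) ≤⟨ m≤m+n _ (2 * v) ⟩
    w * (2 * v) + (v * v + 2 * (w * v)) + 2 * v ≡⟨ g₂ w v ⟩
    v * (v + 2 + 4 * w)               ∎
    where
    g₁ : ∀ w v → (w + v) * (w + v) ≡ w * w + (v * v + 2 * (w * v))
    g₁ = solve-∀
    g₂ : ∀ w v → w * (2 * v) + (v * v + 2 * (w * v)) + 2 * v ≡ v * (v + 2 + 4 * w)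
    g₂ = solve-∀
  -- For w = 2v + u the square exceeds v² + 4vw by exactly wu. So 4p + wu < 4d² is wanted, and it is
  -- multiplied by s = d² to be bounded through wd ≤ α and ud ≤ β.
  ... | inj₂ 2v≤w = +-cancelʳ-< (w * u) _ _ (begin-strict
    4 * p + w * u                     <⟨ *-cancelʳ-< s (4 * p + w * u) (4 * s) scaled ⟩
    4 * s                             ≡⟨ f₇ d ⟩
    2 * d * (2 * d)                   ≡⟨ cong₂ _*_ w+v w+v ⟨
    (w + v) * (w + v)                 ≡⟨ cong (λ c → (c + v) * (c + v)) wu ⟩
    (2 * v + u + v) * (2 * v + u + v) ≤⟨ m≤m+n _ (2 * v) ⟩
    (2 * v + u + v) * (2 * v + u + v) + 2 * v ≡⟨ g₁ v u ⟩
    v * (v + 2 + 4 * (2 * v + u)) + (2 * v + u) * u ≡⟨ cong (λ c → v * (v + 2 + 4 * c) + c * u) wu ⟨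
    v * (v + 2 + 4 * w) + w * u       ∎)
    where
    u α β : ℕ
    u = w ∸ 2 * v
    wu : w ≡ 2 * v + u
    wu = sym (m+[n∸m]≡n 2v≤w)
    g₁ : ∀ v u → (2 * v + u + v) * (2 * v + u + v) + 2 * v ≡ v * (v + 2 + 4 * (2 * v + u)) + (2 * v + u) * u
    g₁ = solve-∀
    α = 4 * p ∸ 2 * s
    2s+wd≤4p : 2 * s + w * d ≤ 4 * p
    2s+wd≤4p = ≤-trans (m≤m+n _ (2 * d)) wd≤
    pα : 4 * p ≡ 2 * s + α
    pα = sym (m+[n∸m]≡n (≤-trans (m≤m+n (2 * s) (w * d)) 2s+wd≤4p))
    wd≤α : w * d ≤ α
    wd≤α = m+n≤o⇒m≤o∸n (w * d) (≤-trans (≤-reflexive (+-comm (w * d) (2 * s))) 2s+wd≤4p)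
    g₂ : ∀ u d → u * d + 4 * (d * (d * 1)) ≡ u * d + 2 * d * (2 * d)
    g₂ = solve-∀
    g₃ : ∀ u d v w → u * d + 2 * d * (w + v) ≡ (u + 2 * w + 2 * v) * d
    g₃ = solve-∀
    g₄ : ∀ u v w → 2 * v + u + 2 * w ≡ u + 2 * w + 2 * v
    g₄ = solve-∀
    g₅ : ∀ w d → (w + 2 * w) * d ≡ 3 * (w * d)
    g₅ = solve-∀
    -- Since w + v = 2d, u = w - 2v equals 3w - 4d, so the left side is 3wd.
    ud : u * d + 4 * s ≤ 3 * α
    ud = begin
      u * d + 4 * s               ≡⟨ g₂ u d ⟩
      u * d + 2 * d * (2 * d)     ≡⟨ cong (λ c → u * d + 2 * d * c) w+v ⟨
      u * d + 2 * d * (w + v)     ≡⟨ g₃ u d v w ⟩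
      (u + 2 * w + 2 * v) * d     ≡⟨ cong (_* d) (g₄ u v w) ⟨
      (2 * v + u + 2 * w) * d     ≡⟨ cong (λ c → (c + 2 * w) * d) wu ⟨
      (w + 2 * w) * d             ≡⟨ g₅ w d ⟩
      3 * (w * d)                 ≤⟨ *-monoʳ-≤ 3 wd≤α ⟩
      3 * α                       ∎
    β = 3 * α ∸ 4 * s
    αβ : 3 * α ≡ β + 4 * s
    αβ = sym (m∸n+n≡m (≤-trans (m≤n+m (4 * s) (u * d)) ud))
    g₆ : ∀ p d w u → (4 * p + w * u) * (d * (d * 1)) ≡ 4 * p * (d * (d * 1)) + (w * d) * (u * d)
    g₆ = solve-∀
    scaled : (4 * p + w * u) * s < 4 * s * s
    scaled = begin-strict
      (4 * p + w * u) * s               ≡⟨ g₆ p d w u ⟩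
      4 * p * s + (w * d) * (u * d)     <⟨ below-product {p} h pα αβ wd≤α (m+n≤o⇒m≤o∸n (u * d) ud) ⟩
      4 * (s * s)                       ≡⟨ *-assoc 4 s s ⟨
      4 * s * s                         ∎

-- Counting decidable subsets of Fin n

ι : Dec A → ℕ
ι a? = if does a? then 1 else 0

ι-yes : (a? : Dec A) → A → ι a? ≡ 1
ι-yes (yes _) _ = refl
ι-yes (no ¬a) a = ⊥-elim (¬a a)

ι-no : (a? : Dec A) → ¬ A → ι a? ≡ 0
ι-no (yes a) ¬a = ⊥-elim (¬a a)
ι-no (no _) _ = refl

ι-mono : (a? : Dec A) (b? : Dec B) → (A → B) → ι a? ≤ ι b?
ι-mono (yes a) b? f = ≤-reflexive (sym (ι-yes b? (f a)))
ι-mono (no _) b? f = z≤n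

ι≤1 : (a? : Dec A) → ι a? ≤ 1
ι≤1 (yes _) = ≤-refl
ι≤1 (no _) = z≤n

sum-mono : {f g : Fin n → ℕ} → (∀ i → f i ≤ g i) → sum f ≤ sum g
sum-mono {zero} le = z≤n
sum-mono {suc n} le = +-mono-≤ (le zero) (sum-mono (le ∘ suc))

sum-mono-< : {f g : Fin n → ℕ} → (∀ i → f i ≤ g i) → ∀ i → f i < g i → sum f < sum g
sum-mono-< le zero lt = +-mono-<-≤ lt (sum-mono (le ∘ suc))
sum-mono-< le (suc i) lt = +-mono-≤-< (le zero) (sum-mono-< (le ∘ suc) i lt)

count : {P : Fin n → Set} → (∀ i → Dec (P i)) → ℕ
count P? = sum (λ i → ι (P? i))

count-mono : {P : Fin n → Set} (P? : ∀ i → Dec (P i)) {Q : Fin n → Set} (Q? : ∀ i → Dec (Q i)) → (∀ i → P i → Q i) → count P? ≤ count Q?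
count-mono P? Q? f = sum-mono (λ i → ι-mono (P? i) (Q? i) (f i))

count-none : {P : Fin n → Set} (P? : ∀ i → Dec (P i)) → (∀ i → ¬ P i) → count P? ≡ 0
count-none {n = n} P? ¬P = trans (sum-cong-≗ (λ i → ι-no (P? i) (¬P i))) (sum-replicate-zero n)

count-all : {P : Fin n → Set} (P? : ∀ i → Dec (P i)) → (∀ i → P i) → count P? ≡ n
count-all {n = zero} P? all = refl
count-all {n = suc n} P? all = cong₂ _+_ (ι-yes (P? zero) (all zero)) (count-all (P? ∘ suc) (all ∘ suc))

count-pos : {P : Fin n → Set} (P? : ∀ i → Dec (P i)) → ∀ i → P i → 1 ≤ count P?
count-pos P? zero p = ≤-trans (≤-reflexive (sym (ι-yes (P? zero) p))) (m≤m+n _ _)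
count-pos P? (suc i) p = ≤-trans (count-pos (P? ∘ suc) i p) (m≤n+m _ _)

-- The form in which disjointness enters double counts: where at most one candidate remains, the sum
-- of the indicators collapses to a single indicator.
count≤ι : {P : Fin n → Set} (P? : ∀ i → Dec (P i)) (a? : Dec A) → (∀ i j → P i → P j → i ≡ j) → (∀ i → P i → A) →
          count P? ≤ ι a?
count≤ι {n = zero} P? a? uniq imp = z≤n
count≤ι {n = suc n} P? a? uniq imp with P? zero
... | yes p = ≤-reflexive (trans (cong suc (count-none (P? ∘ suc) λ i q → zero≢suc (uniq zero (suc i) p q)))
                                 (sym (ι-yes a? (imp zero p))))
  where
  zero≢suc : ∀ {i : Fin n} → ¬ (zero ≡ suc i)
  zero≢suc ()
... | no _ = count≤ι (P? ∘ suc) a? (λ i j p q → suc-injective (uniq (suc i) (suc j) p q)) (imp ∘ suc)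

count-split : {P : Fin n → Set} (P? : ∀ i → Dec (P i)) {Q : Fin n → Set} (Q? : ∀ i → Dec (Q i)) →
              count P? ≡ count (λ i → P? i ×-dec Q? i) + count (λ i → P? i ×-dec ¬? (Q? i))
count-split P? Q? = trans (sum-cong-≗ pointwise) (∑-distrib-+ (λ i → ι (P? i ×-dec Q? i)) (λ i → ι (P? i ×-dec ¬? (Q? i))))
  where
  pointwise : ∀ i → ι (P? i) ≡ ι (P? i ×-dec Q? i) + ι (P? i ×-dec ¬? (Q? i))
  pointwise i with P? i | Q? i
  ... | yes _ | yes _ = refl
  ... | yes _ | no _ = refl
  ... | no _ | _ = refl

remove : {P : Fin n → Set} → (∀ i → Dec (P i)) → ∀ a i → Dec (P i × i ≢ a)
remove P? a i = P? i ×-dec ¬? (i ≟ a)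

count-remove : {P : Fin n → Set} (P? : ∀ i → Dec (P i)) → ∀ a → P a → count P? ≡ suc (count (remove P? a))
count-remove {P = P} P? a p = trans (count-split P? (_≟ a)) (cong (_+ count (remove P? a)) single)
  where
  P∩a? : ∀ i → Dec (P i × i ≡ a)
  P∩a? i = P? i ×-dec (i ≟ a)
  single : count P∩a? ≡ 1
  single = ≤-antisym (count≤ι P∩a? (yes p) (λ { i j (_ , refl) (_ , refl) → refl }) (λ _ _ → p))
                     (count-pos P∩a? a (p , refl))

count-remove-≤ : {P : Fin n → Set} (P? : ∀ i → Dec (P i)) → ∀ a → count P? ≤ ι (P? a) + count (remove P? a)
count-remove-≤ {P = P} P? a = ≤-trans (≤-reflexive (count-split P? (_≟ a)))
  (+-monoˡ-≤ _ (count≤ι (λ i → P? i ×-dec (i ≟ a)) (P? a) (λ { i j (_ , refl) (_ , refl) → refl })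
    (λ { i (p , refl) → p })))

sumOver : List A → (A → ℕ) → ℕ
sumOver [] f = 0
sumOver (a ∷ L) f = f a + sumOver L f

sumOver-mono : (L : List A) {f g : A → ℕ} → (∀ a → a ∈ L → f a ≤ g a) → sumOver L f ≤ sumOver L g
sumOver-mono [] le = z≤n
sumOver-mono (a ∷ L) le = +-mono-≤ (le a (here refl)) (sumOver-mono L (λ b b∈ → le b (there b∈)))

sumOver-const : (L : List A) (c : ℕ) → sumOver L (λ _ → c) ≡ length L * c
sumOver-const [] c = refl
sumOver-const (a ∷ L) c = cong (c +_) (sumOver-const L c)

count≤sumOver : {P : Fin n → Set} (P? : ∀ i → Dec (P i)) (L : List (Fin n)) → (∀ i → P i → i ∈ L) →
                count P? ≤ sumOver L (λ a → ι (P? a))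
count≤sumOver P? [] cover = ≤-reflexive (count-none P? (λ i p → case (cover i p)))
  where
  case : ∀ {i : Fin _} → ¬ (i ∈ [])
  case ()
count≤sumOver {P = P} P? (a ∷ L) cover = ≤-trans (count-remove-≤ P? a) (+-monoʳ-≤ (ι (P? a))
  (≤-trans (count≤sumOver (remove P? a) L cover′)
           (sumOver-mono L (λ b _ → ι-mono (remove P? a b) (P? b) proj₁))))
  where
  cover′ : ∀ i → P i × i ≢ a → i ∈ L
  cover′ i (p , i≢a) with cover i p
  ... | here i≡a = ⊥-elim (i≢a i≡a)
  ... | there i∈L = i∈L

length-filter-tabulate : ∀ {m} {R : Fin m → Set} (R? : ∀ i → Dec (R i)) (f : Fin n → Fin m) →
                         length (filter R? (tabulate f)) ≡ count (R? ∘ f)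
length-filter-tabulate {n = zero} R? f = refl
length-filter-tabulate {n = suc n} R? f with R? (f zero)
... | yes _ = cong suc (length-filter-tabulate R? (f ∘ suc))
... | no _ = length-filter-tabulate R? (f ∘ suc)

elements : {P : Fin n → Set} → (∀ i → Dec (P i)) → List (Fin n)
elements {n = n} P? = filter P? (allFin n)

length-elements : {P : Fin n → Set} (P? : ∀ i → Dec (P i)) → length (elements P?) ≡ count P?
length-elements P? = length-filter-tabulate P? id

-- The elements of L are removed from P one at a time and what is left is enumerated. This supplies
-- the points of a block outside a matching, with an exact count.
complete : {P : Fin n → Set} (P? : ∀ i → Dec (P i)) (L : List (Fin n)) → Unique L → All P L →
           Σ (List (Fin n)) λ L′ → length L + length L′ ≡ count P? × All P L′ × (∀ i → P i → i ∈ L ⊎ i ∈ L′)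
complete P? [] _ _ = elements P? , length-elements P? , All.all-filter P? (allFin _) ,
  λ i p → inj₂ (∈-filter⁺ P? (∈-allFin i) p)
complete {P = P} P? (a ∷ L) (a∉L ∷ uniq) (p ∷ ps)
  with L′ , len , all , cover ← complete (remove P? a) L uniq (All.zipWith (λ { (q , ne) → q , ne ∘ sym }) (ps , a∉L))
  = L′ , trans (cong suc len) (sym (count-remove P? a p)) , All.map proj₁ all , cover′
  where
  cover′ : ∀ i → P i → i ∈ a ∷ L ⊎ i ∈ L′
  cover′ i q with i ≟ a
  ... | yes i≡a = inj₁ (here i≡a)
  ... | no i≢a with cover i (q , i≢a)
  ...   | inj₁ i∈L = inj₁ (there i∈L)
  ...   | inj₂ i∈L′ = inj₂ i∈L′

count-distinct-pairs : {P : Fin n → Set} (P? : ∀ i → Dec (P i)) →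
  sum (λ i → count (λ j → P? i ×-dec P? j ×-dec ¬? (j ≟ i))) ≤ count P? * (count P? ∸ 1)
count-distinct-pairs {n = n} P? = ≤-trans (sum-mono row) (≤-reflexive (trans (sym (*-distribˡ-sum k-1 (λ i → ι (P? i)))) (*-comm k-1 (count P?))))
  where
  k-1 : ℕ
  k-1 = count P? ∸ 1
  row : ∀ i → count (λ j → P? i ×-dec P? j ×-dec ¬? (j ≟ i)) ≤ k-1 * ι (P? i)
  row i with P? i
  ... | yes p = ≤-trans (≤-reflexive (sym (cong (_∸ 1) (count-remove P? i p)))) (≤-reflexive (sym (*-identityʳ k-1)))
  ... | no ¬p = ≤-trans (≤-reflexive (sum-replicate-zero n)) z≤n

-- Matchings

∈⇒↭ : {x : A} {xs : List A} → x ∈ xs → ∃ λ ys → xs ↭ x ∷ ys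
∈⇒↭ x∈xs with ys , zs , refl ← ∈-∃++ x∈xs = _ , shift _ ys zs

AllPairs-resp-↭ : {R : A → A → Set} → (∀ {x y} → R x y → R y x) → ∀ {xs ys} → xs ↭ ys → AllPairs R xs → AllPairs R ys
AllPairs-resp-↭ {A = A} {R} R-sym p = Perm.AllPairs-resp-↭ (setoid A) R-sym (resp₂ R) (↭⇒↭ₛ p)

ι-disjoint : (a? : Dec A) (b? : Dec B) → ¬ (A × B) → ι a? + ι b? ≤ 1
ι-disjoint (yes a) b? ¬ab = ≤-reflexive (cong suc (ι-no b? (λ b → ¬ab (a , b))))
ι-disjoint (no _) b? _ = ι≤1 b?

sumOver-+ : (L : List A) (f g : A → ℕ) → sumOver L (λ a → f a + g a) ≡ sumOver L f + sumOver L g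
sumOver-+ [] f g = refl
sumOver-+ (a ∷ L) f g = trans (cong (f a + g a +_) (sumOver-+ L f g)) (e (f a) (g a) (sumOver L f) (sumOver L g))
  where
  e : ∀ a b c d → a + b + (c + d) ≡ a + c + (b + d)
  e = solve-∀

flatten : List (A × A) → List A
flatten [] = []
flatten ((a , b) ∷ M) = a ∷ b ∷ flatten M

sumOver-flatten : (M : List (A × A)) (f : A → ℕ) → sumOver (flatten M) f ≡ sumOver M (λ (a , b) → f a + f b)
sumOver-flatten [] f = refl
sumOver-flatten ((a , b) ∷ M) f = trans (cong (λ c → f a + (f b + c)) (sumOver-flatten M f)) (sym (+-assoc (f a) (f b) _))

length-flatten : (M : List (A × A)) → length (flatten M) ≡ 2 * length M
length-flatten [] = refl
length-flatten (_ ∷ M) = trans (cong (2 +_) (length-flatten M)) (cong suc (sym (+-suc (length M) (length M + 0))))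

Misses : A → A × A → Set
Misses z (a , b) = z ≢ a × z ≢ b

Apart : A × A → A × A → Set
Apart (a , b) e = Misses a e × Misses b e

Apart-sym : {e e′ : A × A} → Apart e e′ → Apart e′ e
Apart-sym ((a , b) , (c , d)) = (a ∘ sym , c ∘ sym) , (b ∘ sym , d ∘ sym)

∉-flatten : {z : A} (M : List (A × A)) → z ∉ flatten M → All (Misses z) M
∉-flatten [] _ = []
∉-flatten (_ ∷ M) z∉ = ((z∉ ∘ here) , (z∉ ∘ there ∘ here)) ∷ ∉-flatten M (z∉ ∘ there ∘ there)

Misses⇒≢ : {z : A} (M : List (A × A)) → All (Misses z) M → All (z ≢_) (flatten M)
Misses⇒≢ [] [] = []
Misses⇒≢ (_ ∷ M) ((p , q) ∷ ms) = p ∷ q ∷ Misses⇒≢ M ms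

pairUp : List A → List (A × A)
pairUp (a ∷ b ∷ L) = (a , b) ∷ pairUp L
pairUp _ = []

pairUp-length : (L : List A) → length L ≤ suc (2 * length (pairUp L))
pairUp-length [] = z≤n
pairUp-length (_ ∷ []) = ≤-refl
pairUp-length (_ ∷ _ ∷ L) = s≤s (≤-trans (s≤s (pairUp-length L)) (≤-reflexive (sym (cong suc (+-suc (length (pairUp L)) (length (pairUp L) + 0))))))

pairUp-misses : {z : A} (L : List A) → All (z ≢_) L → All (Misses z) (pairUp L)
pairUp-misses [] _ = []
pairUp-misses (_ ∷ []) _ = []
pairUp-misses (_ ∷ _ ∷ L) (p ∷ q ∷ r) = (p , q) ∷ pairUp-misses L r

pairUp-apart : (L : List A) → Unique L → AllPairs Apart (pairUp L)
pairUp-apart [] _ = []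
pairUp-apart (_ ∷ []) _ = []
pairUp-apart (a ∷ b ∷ L) ((_ ∷ pa) ∷ pb ∷ u) = All.zip (pairUp-misses L pa , pairUp-misses L pb) ∷ pairUp-apart L u

pairUp-all : {P : A → Set} (L : List A) → Unique L → All P L → All (λ (a , b) → P a × P b × a ≢ b) (pairUp L)
pairUp-all [] _ _ = []
pairUp-all (_ ∷ []) _ _ = []
pairUp-all (a ∷ b ∷ L) ((a≢b ∷ _) ∷ _ ∷ u) (p ∷ q ∷ ps) = (p , q , a≢b) ∷ pairUp-all L u ps

-- Descent on the value of f: as long as some pair in Q has a smaller value, it replaces the current
-- one.
minimal-pair : ∀ {N} {Q : Fin N → Fin N → Set} (Q? : ∀ u v → Dec (Q u v)) (f : Fin N → Fin N → ℕ) →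
               ∀ u v → Q u v → ∃₂ λ u v → Q u v × (∀ a b → Q a b → f u v ≤ f a b)
minimal-pair {N} {Q} Q? f u v q = go u v q (<-wellFounded (f u v))
  where
  go : ∀ u v → Q u v → Acc _<_ (f u v) → ∃₂ λ u v → Q u v × (∀ a b → Q a b → f u v ≤ f a b)
  go u v q (acc rs) with any? (λ a → any? (λ b → Q? a b ×-dec (f a b <? f u v)))
  ... | yes (a , b , q′ , lt) = go a b q′ (rs lt)
  ... | no none = u , v , q , λ a b q′ → ≮⇒≥ (λ lt → none (a , b , q′ , lt))

-- Graphs whose complement has no large matching

module Graphs {N : ℕ} {V : Fin N → Set} (V? : ∀ z → Dec (V z)) where

  open DecMembership (_≟_ {N}) using (_∈?_)

  Rel : Set₁
  Rel = Fin N → Fin N → Set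

  order : ℕ
  order = count V?

  record IsGraph (H : Rel) : Set where
    field
      adj-sym    : ∀ {u v} → H u v → H v u
      adj-irrefl : ∀ {u} → ¬ H u u
      adj-vertex : ∀ {u v} → H u v → V u

  degree : {H : Rel} → (∀ u v → Dec (H u v)) → Fin N → ℕ
  degree H? u = count (H? u)

  Free : Rel → Fin N × Fin N → Set
  Free H (a , b) = (V a × V b × a ≢ b) × ¬ H a b

  -- A matching in the complement of H within V.
  Matching : Rel → List (Fin N × Fin N) → Set
  Matching H M = All (Free H) M × AllPairs Apart M

  Matching-resp-↭ : ∀ {H : Rel} {M M′} → M ↭ M′ → Matching H M → Matching H M′
  Matching-resp-↭ p (free , apart) = All-resp-↭ p free , AllPairs-resp-↭ Apart-sym p apart

  -- Bondy–Chvátal closure: exchanging ab for a non-edge at a or b, or for two non-edges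
  -- joining a and b to one pair of M, is impossible, which bounds the non-degrees of a and b.
  closure : ∀ {H : Rel} → (H? : ∀ u v → Dec (H u v)) → IsGraph H →
            ∀ {a b M} → H a b → Matching H M → All (Apart (a , b)) M →
            (∀ M′ → Matching H M′ → length M′ ≢ suc (length M)) →
            2 * order ≤ degree H? a + degree H? b + 2 * suc (length M)
  closure {H} H? isGraph {a} {b} {M} ab match@(free , apart) avoid maximal = begin
      2 * order
        ≡⟨ cong (order +_) (+-identityʳ order) ⟩
      order + order
        ≤⟨ +-mono-≤ (order≤ a∈V a-misses) (order≤ b∈V b-misses) ⟩
      degree H? a + suc (nonSum a) + (degree H? b + suc (nonSum b))
        ≡⟨ e₁ (degree H? a) (nonSum a) (degree H? b) (nonSum b) ⟩
      degree H? a + degree H? b + (2 + (nonSum a + nonSum b))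
        ≤⟨ +-monoʳ-≤ (degree H? a + degree H? b) (+-monoʳ-≤ 2 nonSums) ⟩
      degree H? a + degree H? b + (2 + length M * 2)
        ≡⟨ cong (degree H? a + degree H? b +_) (e₂ (length M)) ⟩
      degree H? a + degree H? b + 2 * suc (length M) ∎
    where
    open ≤-Reasoning
    open IsGraph isGraph
    e₁ : ∀ x y z w → x + suc y + (z + suc w) ≡ x + z + (2 + (y + w))
    e₁ = solve-∀
    e₂ : ∀ x → 2 + x * 2 ≡ 2 * suc x
    e₂ = solve-∀
    a∈V : V a
    a∈V = adj-vertex ab
    b∈V : V b
    b∈V = adj-vertex (adj-sym ab)
    a≢b : a ≢ b
    a≢b refl = adj-irrefl ab
    a-misses : All (Misses a) M
    a-misses = All.map proj₁ avoid
    b-misses : All (Misses b) M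
    b-misses = All.map proj₂ avoid
    Non : Fin N → Fin N → Set
    Non c z = V z × ¬ H c z
    Non? : ∀ c z → Dec (Non c z)
    Non? c z = V? z ×-dec ¬? (H? c z)
    nonPair : Fin N → Fin N × Fin N → ℕ
    nonPair c (x , y) = ι (Non? c x) + ι (Non? c y)
    nonSum : Fin N → ℕ
    nonSum c = sumOver M (nonPair c)
    non-cover : ∀ {c} → V c → All (Misses c) M → ∀ z → Non c z → z ∈ c ∷ flatten M
    non-cover {c} c∈V c-misses z (z∈V , ¬cz) with z ∈? (c ∷ flatten M)
    ... | yes z∈ = z∈
    -- A non-neighbour z of c outside c and M would extend M by the pair (c, z).
    ... | no z∉ = ⊥-elim (maximal ((c , z) ∷ M)
      ( ((c∈V , z∈V , z∉ ∘ here ∘ sym) , ¬cz) ∷ free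
      , All.zip (c-misses , ∉-flatten M (z∉ ∘ there)) ∷ apart ) refl)
    -- The 1 added to `nonSum` is for c itself, which is among its own non-neighbours.
    order≤ : ∀ {c} → V c → All (Misses c) M → order ≤ degree H? c + suc (nonSum c)
    order≤ {c} c∈V c-misses = begin
      order
        ≡⟨ count-split V? (H? c) ⟩
      count (λ z → V? z ×-dec H? c z) + count (Non? c)
        ≤⟨ +-mono-≤ (count-mono (λ z → V? z ×-dec H? c z) (H? c) (λ _ → proj₂)) (count≤sumOver (Non? c) (c ∷ flatten M) (non-cover c∈V c-misses)) ⟩
      degree H? c + (ι (Non? c c) + sumOver (flatten M) (λ z → ι (Non? c z)))
        ≤⟨ +-monoʳ-≤ (degree H? c) (+-mono-≤ (ι≤1 (Non? c c)) (≤-reflexive (sumOver-flatten M _))) ⟩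
      degree H? c + suc (nonSum c) ∎
    exchange : ∀ {x y M′} → Matching H M′ → length M ≡ suc (length M′) →
               All (Misses a) M′ → All (Misses b) M′ → All (Misses x) M′ → All (Misses y) M′ →
               Misses a (x , y) → Misses b (x , y) → x ≢ y → ¬ (Non a x × Non b y)
    exchange {x} {y} {M′} (free′ , apart′) len am bm xm ym (a≢x , a≢y) (b≢x , b≢y) x≢y ((x∈V , ¬ax) , (y∈V , ¬by)) =
      maximal ((a , x) ∷ (b , y) ∷ M′)
        ( ((a∈V , x∈V , a≢x) , ¬ax) ∷ ((b∈V , y∈V , b≢y) , ¬by) ∷ free′
        , (((a≢b , a≢y) , (b≢x ∘ sym , x≢y)) ∷ All.zip (am , xm)) ∷ All.zip (bm , ym) ∷ apart′ )
        (cong suc (sym len))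
    pair≤2 : ∀ e → e ∈ M → nonPair a e + nonPair b e ≤ 2
    pair≤2 (x , y) e∈M with M′ , p ← ∈⇒↭ e∈M
      with (((_ , _ , x≢y) , _) ∷ free′) , (e-apart ∷ apart′) ← Matching-resp-↭ p match
      with (am ∷ ams) ← All-resp-↭ p a-misses
      with (bm ∷ bms) ← All-resp-↭ p b-misses = begin
        ι (Non? a x) + ι (Non? a y) + (ι (Non? b x) + ι (Non? b y))
          ≡⟨ e₃ (ι (Non? a x)) (ι (Non? a y)) (ι (Non? b x)) (ι (Non? b y)) ⟩
        -- Each bracket now holds two non-edges that could together replace the pair (x, y) in M.
        (ι (Non? a x) + ι (Non? b y)) + (ι (Non? a y) + ι (Non? b x))
          ≤⟨ +-mono-≤
               (ι-disjoint (Non? a x) (Non? b y)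
                 (exchange (free′ , apart′) len ams bms xms yms am bm x≢y))
               (ι-disjoint (Non? a y) (Non? b x)
                 (exchange (free′ , apart′) len ams bms yms xms (swap am) (swap bm) (x≢y ∘ sym))) ⟩
        2 ∎
      where
      e₃ : ∀ p q r s → p + q + (r + s) ≡ (p + s) + (q + r)
      e₃ = solve-∀
      len : length M ≡ suc (length M′)
      len = ↭-length p
      xms : All (Misses x) M′
      xms = All.map proj₁ e-apart
      yms : All (Misses y) M′
      yms = All.map proj₂ e-apart
    nonSums : nonSum a + nonSum b ≤ length M * 2
    nonSums = begin
      nonSum a + nonSum b                              ≡⟨ sumOver-+ M (nonPair a) (nonPair b) ⟨
      sumOver M (λ e → nonPair a e + nonPair b e)      ≤⟨ sumOver-mono M pair≤2 ⟩
      sumOver M (λ _ → 2)                              ≡⟨ sumOver-const M 2 ⟩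
      length M * 2                                     ∎

  removeEdge : Rel → Fin N → Fin N → Fin N → Fin N → Set
  removeEdge H u v y z = H y z × ¬ (y ≡ u × z ≡ v ⊎ y ≡ v × z ≡ u)

  removeEdge? : ∀ {H : Rel} → (∀ u v → Dec (H u v)) → ∀ u v y z → Dec (removeEdge H u v y z)
  removeEdge? H? u v y z = H? y z ×-dec ¬? ((y ≟ u ×-dec z ≟ v) ⊎-dec (y ≟ v ×-dec z ≟ u))

  removeEdge-isGraph : ∀ {H : Rel} → IsGraph H → ∀ u v → IsGraph (removeEdge H u v)
  removeEdge-isGraph isGraph u v = record
    { adj-sym    = λ { (yz , ¬uv) → adj-sym yz , λ { (inj₁ (p , q)) → ¬uv (inj₂ (q , p)) ; (inj₂ (p , q)) → ¬uv (inj₁ (q , p)) } }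
    ; adj-irrefl = λ { (yy , _) → adj-irrefl yy }
    ; adj-vertex = λ { (yz , _) → adj-vertex yz }
    }
    where open IsGraph isGraph

  -- Ordered pairs are counted, so for a graph this is twice the number of edges.
  size : ∀ {H : Rel} → (∀ u v → Dec (H u v)) → ℕ
  size H? = sum (degree H?)

  removeEdge-size : ∀ {H : Rel} (H? : ∀ u v → Dec (H u v)) → ∀ u v → H u v → size (removeEdge? H? u v) < size H?
  removeEdge-size H? u v uv =
    sum-mono-< (λ y → sum-mono (smaller y)) u (sum-mono-< (smaller u) v
      (≤-trans (≤-reflexive (cong suc (ι-no (removeEdge? H? u v u v) (λ { (_ , ¬uv) → ¬uv (inj₁ (refl , refl)) }))))
               (≤-reflexive (sym (ι-yes (H? u v) uv)))))
    where
    smaller : ∀ y z → ι (removeEdge? H? u v y z) ≤ ι (H? y z)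
    smaller y z = ι-mono (removeEdge? H? u v y z) (H? y z) proj₁

  -- No matching of size `order` - d exists in the complement, written without subtraction. The
  -- empty matching yields d < `order`.
  MatchingsBelow : ℕ → Rel → Set
  MatchingsBelow d H = ∀ M → Matching H M → d + length M < order

  -- A matching M that breaks the bound after the removal must use the pair uv. Without that pair it
  -- is a matching M′ for H that avoids u and v, and no matching for H has one pair more. `closure`
  -- then makes the degree sum of u and v at least 2(`order` - |M′| - 1), which is at least 2d.
  removeEdge-matchings : ∀ {d} {H : Rel} (H? : ∀ u v → Dec (H u v)) → IsGraph H → ∀ {u v} → H u v →
                         degree H? u + degree H? v < 2 * d →
                         MatchingsBelow d H → MatchingsBelow d (removeEdge H u v)
  removeEdge-matchings {d} {H} H? isGraph {u} {v} uv small below M (free , apart)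
    with All.all? (λ (a , b) → ¬? (H? a b)) M
  ... | yes ¬H = below M (All.zipWith (λ ((vs , _) , ¬ab) → vs , ¬ab) (free , ¬H) , apart)
  ... | no someH
    with (a , b) , e∈M , ¬¬ab ← find (All.¬All⇒Any¬ (λ (a , b) → ¬? (H? a b)) M someH)
    with M′ , p ← ∈⇒↭ e∈M
    with (_ , ¬ab′) ∷ free′ , e-apart ∷ apart′ ← Matching-resp-↭ {removeEdge H u v} p (free , apart)
    = ≰⇒> λ order≤ → <-irrefl refl (begin-strict
        2 * order
          ≤⟨ closure H? isGraph ab match e-apart (maximal order≤) ⟩
        degree H? a + degree H? b + 2 * suc (length M′)
          ≡⟨ cong (_+ 2 * suc (length M′)) degrees ⟩
        degree H? u + degree H? v + 2 * suc (length M′)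
          <⟨ +-monoˡ-< (2 * suc (length M′)) small ⟩
        2 * d + 2 * suc (length M′)
          ≡⟨ *-distribˡ-+ 2 d (suc (length M′)) ⟨
        2 * (d + suc (length M′))
          ≡⟨ cong (2 *_) (+-suc d (length M′)) ⟩
        2 * suc (d + length M′)
          ≤⟨ *-monoʳ-≤ 2 (below M′ match) ⟩
        2 * order ∎)
    where
    open ≤-Reasoning
    open IsGraph isGraph
    ab : H a b
    ab = decidable-stable (H? a b) ¬¬ab
    uv≡ab : a ≡ u × b ≡ v ⊎ a ≡ v × b ≡ u
    uv≡ab = decidable-stable ((a ≟ u ×-dec b ≟ v) ⊎-dec (a ≟ v ×-dec b ≟ u)) (λ ne → ¬ab′ (ab , ne))
    degrees : degree H? a + degree H? b ≡ degree H? u + degree H? v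
    degrees with uv≡ab
    ... | inj₁ (refl , refl) = refl
    ... | inj₂ (refl , refl) = +-comm (degree H? v) (degree H? u)
    keep : ∀ {e} → Free (removeEdge H u v) e × Apart (a , b) e → Free H e
    keep ((vs , ¬xy) , (a≢x , a≢y) , (b≢x , b≢y)) = vs , λ xy → ¬xy (xy , other uv≡ab)
      where
      other : a ≡ u × b ≡ v ⊎ a ≡ v × b ≡ u → ¬ _
      other (inj₁ (refl , refl)) (inj₁ (x≡u , _)) = a≢x (sym x≡u)
      other (inj₁ (refl , refl)) (inj₂ (x≡v , _)) = b≢x (sym x≡v)
      other (inj₂ (refl , refl)) (inj₁ (x≡u , _)) = b≢x (sym x≡u)
      other (inj₂ (refl , refl)) (inj₂ (x≡v , _)) = a≢x (sym x≡v)
    match : Matching H M′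
    match = All.zipWith keep (free′ , e-apart) , apart′
    maximal : order ≤ d + length M → ∀ M″ → Matching H M″ → length M″ ≢ suc (length M′)
    maximal order≤ M″ match″ len = <-irrefl refl (begin-strict
      d + length M″   <⟨ below M″ match″ ⟩
      order           ≤⟨ order≤ ⟩
      d + length M    ≡⟨ cong (d +_) (trans (↭-length p) (sym len)) ⟩
      d + length M″   ∎)

  -- Chvátal's count, at an edge uv of least degree sum.
  size-lower-bound : ∀ {H : Rel} (H? : ∀ u v → Dec (H u v)) → IsGraph H → ∀ {u v} → H u v →
                     (∀ a b → H a b → degree H? u + degree H? v ≤ degree H? a + degree H? b) →
                     degree H? v ≤ degree H? u →
                     ∃₂ λ b w → degree H? u + degree H? v ≡ 2 * b + w × suc (b + w) ≤ order ×
                                b * (b + 1 + 2 * w) ≤ size H?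
  size-lower-bound {H} H? isGraph {u} {v} uv least v≤u = b , w , sums , room , (begin
      b * (b + 1 + 2 * w)
        -- The bound is b(deg u + 1) + w deg v: weight b on u and each neighbour of u, and a further
        -- w on each neighbour of v.
        ≡⟨ e₂ b w ⟩
      b * ((b + w) + 1) + w * b
        ≡⟨ cong (λ c → b * (c + 1) + w * b) b+w ⟩
      b * (degree H? u + 1) + w * degree H? v
        ≡⟨ cong (λ c → b * (degree H? u + c) + w * degree H? v) single ⟨
      b * (sum (λ z → ι (H? u z)) + sum (λ z → ι (z ≟ u))) + w * sum (λ z → ι (H? v z))
        ≡⟨ cong (λ c → b * c + w * sum (λ z → ι (H? v z))) (∑-distrib-+ (λ z → ι (H? u z)) (λ z → ι (z ≟ u))) ⟨
      b * sum (λ z → ι (H? u z) + ι (z ≟ u)) + w * sum (λ z → ι (H? v z))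
        ≡⟨ cong₂ _+_ (*-distribˡ-sum b (λ z → ι (H? u z) + ι (z ≟ u))) (*-distribˡ-sum w (λ z → ι (H? v z))) ⟩
      sum (λ z → b * (ι (H? u z) + ι (z ≟ u))) + sum (λ z → w * ι (H? v z))
        ≡⟨ ∑-distrib-+ (λ z → b * (ι (H? u z) + ι (z ≟ u))) (λ z → w * ι (H? v z)) ⟨
      sum (λ z → b * (ι (H? u z) + ι (z ≟ u)) + w * ι (H? v z))
        ≤⟨ sum-mono pointwise ⟩
      size H? ∎)
    where
    open ≤-Reasoning
    open IsGraph isGraph
    b w : ℕ
    b = degree H? v
    w = degree H? u ∸ degree H? v
    b+w : b + w ≡ degree H? u
    b+w = m+[n∸m]≡n v≤u
    e₁ : ∀ b w → b + w + b ≡ 2 * b + w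
    e₁ = solve-∀
    e₂ : ∀ b w → b * (b + 1 + 2 * w) ≡ b * ((b + w) + 1) + w * b
    e₂ = solve-∀
    sums : degree H? u + degree H? v ≡ 2 * b + w
    sums = trans (cong (_+ b) (sym b+w)) (e₁ b w)
    room : suc (b + w) ≤ order
    room = begin
      suc (b + w)              ≡⟨ cong suc b+w ⟩
      suc (degree H? u)        ≤⟨ s≤s (count-mono (H? u) (remove V? u) (λ z uz → adj-vertex (adj-sym uz) , λ { refl → adj-irrefl uz })) ⟩
      suc (count (remove V? u)) ≡⟨ count-remove V? u (adj-vertex uv) ⟨
      order                    ∎
    single : sum (λ z → ι (z ≟ u)) ≡ 1
    single = ≤-antisym (count≤ι (_≟ u) (yes uv) (λ { i j refl refl → refl }) (λ _ _ → uv)) (count-pos (_≟ u) u refl)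
    -- Minimality of the degree sum at uv gives a neighbour of v degree at least deg u = b + w, and
    -- a neighbour of u degree at least deg v = b. The vertex u carries exactly its degree.
    pointwise : ∀ z → b * (ι (H? u z) + ι (z ≟ u)) + w * ι (H? v z) ≤ degree H? z
    pointwise z with z ≟ u
    ... | yes refl = ≤-reflexive (trans (cong₂ (λ x y → b * (x + 1) + w * y) (ι-no (H? u u) adj-irrefl) (ι-yes (H? v u) (adj-sym uv)))
                                        (trans (cong₂ _+_ (*-identityʳ b) (*-identityʳ w)) b+w))
    ... | no z≢u with H? v z
    ...   | yes vz = begin
        b * (ι (H? u z) + 0) + w * 1   ≤⟨ +-mono-≤ (*-monoʳ-≤ b (≤-trans (≤-reflexive (+-identityʳ _)) (ι≤1 (H? u z)))) (≤-reflexive (*-identityʳ w)) ⟩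
        b * 1 + w                      ≡⟨ cong (_+ w) (*-identityʳ b) ⟩
        b + w                          ≡⟨ b+w ⟩
        degree H? u                    ≤⟨ +-cancelˡ-≤ (degree H? v) _ _ (≤-trans (≤-reflexive (+-comm (degree H? v) (degree H? u))) (least v z vz)) ⟩
        degree H? z                    ∎
    ...   | no _ with H? u z
    ...     | yes uz = begin
        b * 1 + w * 0   ≡⟨ cong₂ _+_ (*-identityʳ b) (*-zeroʳ w) ⟩
        b + 0           ≡⟨ +-identityʳ b ⟩
        degree H? v     ≤⟨ +-cancelˡ-≤ (degree H? u) _ _ (least u z uz) ⟩
        degree H? z     ∎
    ...     | no _ = ≤-trans (≤-reflexive (cong₂ _+_ (*-zeroʳ b) (*-zeroʳ w))) z≤n

  -- The Erdős–Gallai theorem on matchings, for the complement of H.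
  erdős-gallai : ∀ {d} {H : Rel} (H? : ∀ u v → Dec (H u v)) → IsGraph H → order ≤ 2 * d → MatchingsBelow d H →
                 ∃₂ λ b w → 2 * d ≤ 2 * b + w × suc (b + w) ≤ order × b * (b + 1 + 2 * w) ≤ size H?
  erdős-gallai {d} H? isGraph order≤2d below = go H? isGraph below (<-wellFounded (size H?))
    where
    open ≤-Reasoning
    Bound : ∀ {H : Rel} (H? : ∀ u v → Dec (H u v)) → Set
    Bound H? = ∃₂ λ b w → 2 * d ≤ 2 * b + w × suc (b + w) ≤ order × b * (b + 1 + 2 * w) ≤ size H?
    go : ∀ {H : Rel} (H? : ∀ u v → Dec (H u v)) → IsGraph H → MatchingsBelow d H → Acc _<_ (size H?) → Bound H?
    go {H} H? isGraph below (acc rs) with any? (λ u → any? (λ v → H? u v))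
    -- Without edges, pairing off all vertices but at most one is a matching. The hypothesis on
    -- matchings then gives d ≤ |M|, against `order` ≤ 2d.
    ... | no empty = ⊥-elim (<-irrefl refl (begin-strict
        2 * d                     ≡⟨ cong (d +_) (+-identityʳ d) ⟩
        d + d                     ≤⟨ +-monoʳ-≤ d d≤ ⟩
        d + length M              <⟨ below M match ⟩
        order                     ≤⟨ order≤2d ⟩
        2 * d                     ∎))
      where
      L : List (Fin N)
      L = elements V?
      L-unique : Unique L
      L-unique = Unique.filter⁺ V? (Unique.allFin⁺ N)
      M : List (Fin N × Fin N)
      M = pairUp L
      match : Matching H M
      match = All.map (λ vs → vs , λ ab → empty (_ , _ , ab)) (pairUp-all L L-unique (All.all-filter V? (allFin N)))
            , pairUp-apart L L-unique
      d≤ : d ≤ length M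
      d≤ = s≤s⁻¹ (+-cancelʳ-≤ (length M) _ _ (begin
        suc (d + length M)          ≤⟨ below M match ⟩
        order                       ≡⟨ length-elements V? ⟨
        length L                    ≤⟨ pairUp-length L ⟩
        suc (2 * length M)          ≡⟨ cong (λ c → suc (length M + c)) (+-identityʳ (length M)) ⟩
        suc (length M) + length M   ∎))
    ... | yes (u₀ , v₀ , uv₀)
      with u , v , uv , least ← minimal-pair H? (λ a b → degree H? a + degree H? b) u₀ v₀ uv₀
      with degree H? u + degree H? v <? 2 * d
    -- An edge of degree sum below 2d is removed: the matching bound persists, and a lower bound for
    -- the smaller graph holds for H too.
    ... | yes small
      with b , w , p , q , r ← go (removeEdge? H? u v) (removeEdge-isGraph isGraph u v)
                                  (removeEdge-matchings H? isGraph uv small below)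
                                  (rs (removeEdge-size H? u v uv))
      = b , w , p , q , ≤-trans r (<⇒≤ (removeEdge-size H? u v uv))
    -- Otherwise every edge has degree sum at least 2d and the count applies, with the endpoint of
    -- smaller degree in the role of v.
    ... | no large with ≤-total (degree H? v) (degree H? u)
    ...   | inj₁ v≤u with b , w , p , q , r ← size-lower-bound H? isGraph uv least v≤u
      = b , w , ≤-trans (≮⇒≥ large) (≤-reflexive p) , q , r
    ...   | inj₂ u≤v with b , w , p , q , r ← size-lower-bound H? isGraph (IsGraph.adj-sym isGraph uv)
                                (λ a b ab → ≤-trans (≤-reflexive (+-comm (degree H? v) (degree H? u))) (least a b ab)) u≤v
      = b , w , ≤-trans (≮⇒≥ large) (≤-reflexive (trans (+-comm (degree H? u) (degree H? v)) p)) , q , r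

-- Disjunct families

-- Double counting of the relation T, which acts as an injection from S to Q that may take several
-- values.
count≤count : ∀ {m n} {S : Fin m → Set} {Q : Fin n → Set} {T : Fin m → Fin n → Set}
              (S? : ∀ b → Dec (S b)) (Q? : ∀ x → Dec (Q x)) (T? : ∀ b x → Dec (T b x)) →
              (∀ b → S b → ∃ (T b)) → (∀ {b x} → T b x → Q x) → (∀ {b c x} → T b x → T c x → b ≡ c) →
              count S? ≤ count Q?
count≤count S? Q? T? total range injective = begin
  count S?                              ≤⟨ sum-mono some ⟩
  sum (λ b → sum (λ x → ι (T? b x)))    ≡⟨ ∑-comm (λ b x → ι (T? b x)) ⟩
  sum (λ x → sum (λ b → ι (T? b x)))    ≤⟨ sum-mono (λ x → count≤ι (λ b → T? b x) (Q? x) (λ _ _ → injective) (λ _ → range)) ⟩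
  count Q?                              ∎
  where
  open ≤-Reasoning
  some : ∀ b → ι (S? b) ≤ sum (λ x → ι (T? b x))
  some b with S? b
  ... | yes s = let x , t = total b s in count-pos (T? b) x t
  ... | no _ = z≤n

ι-*-≤ : {A : Set} (a? : Dec A) {k n : ℕ} → (A → k ≤ n) → ι a? * k ≤ n
ι-*-≤ (yes a) le = ≤-trans (≤-reflexive (+-identityʳ _)) (le a)
ι-*-≤ (no _) le = z≤n

flatten-unique : {A : Set} (M : List (A × A)) → All (λ (x , y) → x ≢ y) M → AllPairs Apart M → Unique (flatten M)
flatten-unique [] _ _ = []
flatten-unique (_ ∷ M) (x≢y ∷ ne) (ap ∷ aps) =
  (x≢y ∷ Misses⇒≢ M (All.map proj₁ ap)) ∷ Misses⇒≢ M (All.map proj₂ ap) ∷ flatten-unique M ne aps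

flatten-all : {A : Set} {P : A → Set} (M : List (A × A)) → All (λ (x , y) → P x × P y) M → All P (flatten M)
flatten-all [] [] = []
flatten-all (_ ∷ M) ((p , q) ∷ ps) = p ∷ q ∷ flatten-all M ps

module Families {m p : ℕ} {F : Fin m → Fin p → Set} (F? : ∀ b x → Dec (F b x)) where

  -- The predicates A and P select the blocks and points in use, so that the induction can delete
  -- some of each while F stays fixed.
  Disjunct : ℕ → (Fin m → Set) → (Fin p → Set) → Set
  Disjunct d A P = ∀ b → A b → ∀ L → length L ≤ d → All (λ c → A c × c ≢ b) L →
                   ∃ λ x → P x × F b x × All (λ c → ¬ F c x) L

  Private : (Fin m → Set) → (Fin p → Set) → Fin m → Fin p → Set
  Private A P b x = (P x × F b x) × (∀ c → A c → F c x → c ≡ b)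

  Private? : ∀ {A : Fin m → Set} {P : Fin p → Set} → (∀ b → Dec (A b)) → (∀ x → Dec (P x)) → ∀ b x → Dec (Private A P b x)
  Private? A? P? b x = (P? x ×-dec F? b x) ×-dec all? (λ c → A? c →-dec (F? c x →-dec (c ≟ b)))

  -- The surplus 2 is what excludes the second alternative for a code of size n, which gives n - 1
  -- blocks on n points.
  Dichotomy : ∀ {A : Fin m → Set} {P : Fin p → Set} → (∀ b → Dec (A b)) → (∀ x → Dec (P x)) → Set
  Dichotomy {A} {P} A? P? = (∀ b → A b → ∃ (Private A P b)) ⊎ count A? + 2 ≤ count P?

  dichotomy⇒≤ : ∀ {A : Fin m → Set} {P : Fin p → Set} (A? : ∀ b → Dec (A b)) (P? : ∀ x → Dec (P x)) →
                Dichotomy A? P? → count A? ≤ count P?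
  dichotomy⇒≤ {A} {P} A? P? (inj₂ le) = ≤-trans (m≤m+n _ 2) le
  dichotomy⇒≤ {A} {P} A? P? (inj₁ private′) = count≤count A? P? (λ b x → A? b ×-dec Private? A? P? b x)
    (λ b a → let x , pr = private′ b a in x , a , pr)
    (λ (_ , (px , _) , _) → px)
    (λ { (a , (_ , fx) , _) (_ , _ , own) → own _ a fx })

  module Reduction {A : Fin m → Set} {P : Fin p → Set} (A? : ∀ b → Dec (A b)) (P? : ∀ x → Dec (P x)) where

    HasPrivate : Fin m → Set
    HasPrivate b = ∃ (Private A P b)

    HasPrivate? : ∀ b → Dec (HasPrivate b)
    HasPrivate? b = any? (Private? A? P? b)

    R : Fin m → Set
    R b = A b × ¬ HasPrivate b

    R? : ∀ b → Dec (R b)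
    R? b = A? b ×-dec ¬? (HasPrivate? b)

    Owned : Fin p → Set
    Owned x = ∃ λ b → A b × Private A P b x

    Owned? : ∀ x → Dec (Owned x)
    Owned? x = any? (λ b → A? b ×-dec Private? A? P? b x)

    P′ : Fin p → Set
    P′ x = P x × ¬ Owned x

    P′? : ∀ x → Dec (P′ x)
    P′? x = P? x ×-dec ¬? (Owned? x)

    p′ : ℕ
    p′ = count P′?

    V : Fin m → Fin p → Set
    V b x = P′ x × F b x

    V? : ∀ b x → Dec (V b x)
    V? b x = P′? x ×-dec F? b x

    -- The competing blocks c range over all of A, discarded blocks included, since these too may
    -- serve to cover b.
    OwnPair : Fin m → Fin p → Fin p → Set
    OwnPair b x y = (V b x × V b y × x ≢ y) × (∀ c → A c → F c x → F c y → c ≡ b)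

    OwnPair? : ∀ b x y → Dec (OwnPair b x y)
    OwnPair? b x y = (V? b x ×-dec V? b y ×-dec ¬? (x ≟ y)) ×-dec
                     all? (λ c → A? c →-dec (F? c x →-dec (F? c y →-dec (c ≟ b))))

    -- Each discarded block takes along a private point of its own, so restoring them adds at least
    -- as many points as blocks.
    reduce : count R? + 2 ≤ p′ → count A? + 2 ≤ count P?
    reduce le = begin
      count A? + 2
        ≡⟨ cong (_+ 2) (count-split A? HasPrivate?) ⟩
      count (λ b → A? b ×-dec HasPrivate? b) + count R? + 2
        ≡⟨ +-assoc (count (λ b → A? b ×-dec HasPrivate? b)) (count R?) 2 ⟩
      count (λ b → A? b ×-dec HasPrivate? b) + (count R? + 2)
        ≤⟨ +-mono-≤ owners le ⟩
      count (λ x → P? x ×-dec Owned? x) + p′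
        ≡⟨ count-split P? Owned? ⟨
      count P? ∎
      where
      open ≤-Reasoning
      owners : count (λ b → A? b ×-dec HasPrivate? b) ≤ count (λ x → P? x ×-dec Owned? x)
      owners = count≤count (λ b → A? b ×-dec HasPrivate? b) (λ x → P? x ×-dec Owned? x)
        (λ b x → A? b ×-dec Private? A? P? b x)
        (λ b (a , x , pr) → x , a , pr)
        (λ { {b} (a , pr@((px , _) , _)) → px , b , a , pr })
        (λ { (a , (_ , fx) , _) (_ , _ , own) → own _ a fx })

    -- If some c owned x, then b, which contains x, would equal c and have a private point. Hence a
    -- block of R loses no points in the passage from P to `P′`.
    private-free : ∀ {b x} → R b → P x → F b x → P′ x
    private-free {b} {x} (a , none) px fx = px , λ { (c , _ , (_ , own)) → none (x , (px , fx) , owned own) }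
      where
      owned : ∀ {c} → (∀ c′ → A c′ → F c′ x → c′ ≡ c) → ∀ c′ → A c′ → F c′ x → c′ ≡ b
      owned own c′ a′ fx′ = trans (own c′ a′ fx′) (sym (own b a fx))

    Other : Fin m → Fin m → Set
    Other b c = A c × c ≢ b

    other-point : ∀ {b x} → R b → V b x → ∃ λ c → Other b c × F c x
    other-point {b} {x} (_ , none) ((px , _) , fx) with any? (λ c → (A? c ×-dec ¬? (c ≟ b)) ×-dec F? c x)
    ... | yes found = found
    ... | no no-other = ⊥-elim (none (x , (px , fx) , λ c a fc →
      decidable-stable (c ≟ b) (λ c≢b → no-other (c , (a , c≢b) , fc))))

    other-pair : ∀ {b x y} → V b x × V b y × x ≢ y → ¬ OwnPair b x y → ∃ λ c → Other b c × F c x × F c y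
    other-pair {b} {x} {y} vs ¬own with any? (λ c → (A? c ×-dec ¬? (c ≟ b)) ×-dec F? c x ×-dec F? c y)
    ... | yes found = found
    ... | no no-other = ⊥-elim (¬own (vs , λ c a fx fy →
      decidable-stable (c ≟ b) (λ c≢b → no-other (c , (a , c≢b) , fx , fy))))

    Cover : Fin m → List (Fin p) → ℕ → Set
    Cover b xs k = ∃ λ cs → length cs ≡ k × All (Other b) cs × (∀ {x} → x ∈ xs → Any (λ c → F c x) cs)

    cover-points : ∀ {b} → R b → ∀ xs → All (V b) xs → Cover b xs (length xs)
    cover-points r [] [] = [] , refl , [] , λ ()
    cover-points r (x ∷ xs) (v ∷ vs)
      with c , other , fx ← other-point r v | cs , len , others , cover ← cover-points r xs vs
      = c ∷ cs , cong suc len , other ∷ others , λ { (here refl) → here fx ; (there x∈) → there (cover x∈) }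

    cover-pairs : ∀ {b} M → All (Graphs.Free (V? b) (OwnPair b)) M → Cover b (flatten M) (length M)
    cover-pairs [] [] = [] , refl , [] , λ ()
    cover-pairs ((x , y) ∷ M) ((vs , ¬own) ∷ free)
      with c , other , fx , fy ← other-pair vs ¬own | cs , len , others , cover ← cover-pairs M free
      = c ∷ cs , cong suc len , other ∷ others ,
        λ { (here refl) → here fx ; (there (here refl)) → here fy ; (there (there x∈)) → there (cover x∈) }

    -- Otherwise one other block per matched pair and one per remaining point would cover b by d blocks.
    matchings-below : ∀ {d} → Disjunct d A P → ∀ {b} → R b → Graphs.MatchingsBelow (V? b) d (OwnPair b)
    matchings-below {d} disjunct {b} r M (free , apart) = ≰⇒> covered
      where
      open ≤-Reasoning
      e : ∀ a b → a + b + a ≡ 2 * a + b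
      e = solve-∀
      covered : ¬ (count (V? b) ≤ d + length M)
      covered le
        with xs , len-xs , vs , exhaust ← complete (V? b) (flatten M)
               (flatten-unique M (All.map (λ ((_ , _ , x≢y) , _) → x≢y) free) apart)
               (flatten-all M (All.map (λ ((vx , vy , _) , _) → vx , vy) free))
        with cs , len-cs , others , cover ← cover-pairs M free
        with cs′ , len-cs′ , others′ , cover′ ← cover-points r xs vs
        with x , px , fx , uncovered ← disjunct b (proj₁ r) (cs ++ cs′) (+-cancelʳ-≤ (length M) _ _ (begin
               length (cs ++ cs′) + length M      ≡⟨ cong (_+ length M) (trans (length-++ cs) (cong₂ _+_ len-cs len-cs′)) ⟩
               length M + length xs + length M    ≡⟨ e (length M) (length xs) ⟩
               2 * length M + length xs           ≡⟨ cong (_+ length xs) (length-flatten M) ⟨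
               length (flatten M) + length xs     ≡⟨ len-xs ⟩
               count (V? b)                       ≤⟨ le ⟩
               d + length M                       ∎)) (All.++⁺ others others′)
        with exhaust x (private-free r px fx , fx)
      ... | inj₁ x∈ = All.All¬⇒¬Any uncovered (Any.++⁺ˡ (cover x∈))
      ... | inj₂ x∈ = All.All¬⇒¬Any uncovered (Any.++⁺ʳ cs (cover′ x∈))

    -- After exchanging the sums, each ordered pair of distinct points is counted for at most one
    -- block.
    own-pairs-disjoint : sum (λ b → sum (λ x → sum (λ y → ι (R? b ×-dec OwnPair? b x y)))) ≤ p′ * (p′ ∸ 1)
    own-pairs-disjoint = begin
      sum (λ b → sum (λ x → sum (λ y → own b x y)))   ≡⟨ ∑-comm (λ b x → sum (λ y → own b x y)) ⟩
      sum (λ x → sum (λ b → sum (λ y → own b x y)))   ≡⟨ sum-cong-≗ (λ x → ∑-comm (λ b y → own b x y)) ⟩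
      sum (λ x → sum (λ y → sum (λ b → own b x y)))   ≤⟨ sum-mono (λ x → sum-mono (λ y → one x y)) ⟩
      sum (λ x → sum (λ y → ι (P′? x ×-dec P′? y ×-dec ¬? (y ≟ x)))) ≤⟨ count-distinct-pairs P′? ⟩
      p′ * (p′ ∸ 1)                                   ∎
      where
      open ≤-Reasoning
      own : Fin m → Fin p → Fin p → ℕ
      own b x y = ι (R? b ×-dec OwnPair? b x y)
      one : ∀ x y → sum (λ b → own b x y) ≤ ι (P′? x ×-dec P′? y ×-dec ¬? (y ≟ x))
      one x y = count≤ι (λ b → R? b ×-dec OwnPair? b x y) (P′? x ×-dec P′? y ×-dec ¬? (y ≟ x))
        (λ { b c ((a , _) , ((_ , fx) , (_ , fy) , _) , _) (_ , _ , own-c) → own-c b a fx fy })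
        (λ { b (_ , ((px , _) , (py , _) , x≢y) , _) → px , py , x≢y ∘ sym })

    -- Every block of R has at least p′ + 1 own ordered pairs, and all of them lie among the p′(p′ -
    -- 1) ordered pairs of distinct points.
    small-blocks : ∀ {d} → Disjunct d A P → Below p′ (d ^ 2) → 1 ≤ d → ∃ R →
                   (∀ b → R b → count (V? b) * d ^ 2 + p′ < 2 * d * p′) → count R? + 2 ≤ p′
    small-blocks {d} disjunct below d≥1 (r₀ , r₀∈R) small = pigeon p′ (count R?) p′≥2 (begin
      count R? * suc p′                                ≡⟨ *-distribʳ-sum (suc p′) (λ b → ι (R? b)) ⟩
      sum (λ b → ι (R? b) * suc p′)                    ≤⟨ sum-mono many ⟩
      sum (λ b → sum (λ x → sum (λ y → ι (R? b ×-dec OwnPair? b x y)))) ≤⟨ own-pairs-disjoint ⟩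
      p′ * (p′ ∸ 1)                                    ∎)
      where
      open ≤-Reasoning
      isGraph : ∀ b → Graphs.IsGraph (V? b) (OwnPair b)
      isGraph b = record
        { adj-sym    = λ ((vx , vy , x≢y) , own) → (vy , vx , x≢y ∘ sym) , λ c a fx fy → own c a fy fx
        ; adj-irrefl = λ ((_ , _ , x≢x) , _) → x≢x refl
        ; adj-vertex = λ ((vx , _) , _) → vx
        }
      order≤2d : ∀ b → R b → count (V? b) ≤ 2 * d
      order≤2d b r = <⇒≤ (*-cancelʳ-< (d ^ 2) (count (V? b)) (2 * d) (begin-strict
        count (V? b) * d ^ 2        ≤⟨ m≤m+n _ p′ ⟩
        count (V? b) * d ^ 2 + p′   <⟨ small b r ⟩
        2 * d * p′                  ≤⟨ *-monoʳ-≤ (2 * d) (<⇒≤ (below⇒< below)) ⟩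
        2 * d * d ^ 2               ∎))
      many : ∀ b → ι (R? b) * suc p′ ≤ sum (λ x → sum (λ y → ι (R? b ×-dec OwnPair? b x y)))
      many b = ι-*-≤ (R? b) λ r →
        let c , w , edge , room , size = Graphs.erdős-gallai (V? b) (OwnPair? b) (isGraph b) (order≤2d b r)
                                           (matchings-below disjunct r)
        in begin
          suc p′                                        ≤⟨ below⇒own-pairs {d} {p′} {count (V? b)} {c} {w} below (small b r) edge room ⟩
          c * (c + 1 + 2 * w)                           ≤⟨ size ⟩
          sum (λ x → sum (λ y → ι (OwnPair? b x y)))    ≤⟨ sum-mono (λ x → sum-mono (λ y →
                                                             ι-mono (OwnPair? b x y) (R? b ×-dec OwnPair? b x y) (r ,_))) ⟩
          sum (λ x → sum (λ y → ι (R? b ×-dec OwnPair? b x y))) ∎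
      p′≥2 : 2 ≤ p′
      p′≥2 = begin
        2                 ≤⟨ s≤s d≥1 ⟩
        suc d             ≡⟨ cong suc (+-identityʳ d) ⟨
        suc (d + 0)       ≤⟨ matchings-below disjunct r₀∈R [] ([] , []) ⟩
        count (V? r₀)     ≤⟨ count-mono (V? r₀) P′? (λ _ → proj₁) ⟩
        p′                ∎
      -- If r ≥ p - 1, then p² - 1 ≤ p² - p, which fails for p ≥ 2.
      pigeon : ∀ p r → 2 ≤ p → r * suc p ≤ p * (p ∸ 1) → r + 2 ≤ p
      pigeon (suc q) r (s≤s q≥1) le with r + 2 ≤? suc q
      ... | yes done = done
      ... | no large = ⊥-elim (<-irrefl refl (begin-strict
        q * suc q           <⟨ *-monoʳ-< q {{>-nonZero q≥1}} (n<1+n (suc q)) ⟩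
        q * suc (suc q)     ≤⟨ *-monoˡ-≤ (suc (suc q)) q≤r ⟩
        r * suc (suc q)     ≤⟨ le ⟩
        suc q * q           ≡⟨ *-comm (suc q) q ⟩
        q * suc q           ∎))
        where
        q≤r : q ≤ r
        q≤r = s≤s⁻¹ (s≤s⁻¹ (≤-trans (≰⇒> large) (≤-reflexive (+-comm r 2))))

  DichotomyAt : ℕ → Set₁
  DichotomyAt d = ∀ {A : Fin m → Set} {P : Fin p → Set} (A? : ∀ b → Dec (A b)) (P? : ∀ x → Dec (P x)) →
                  Disjunct d A P → Below (count P?) (d ^ 2) → Dichotomy A? P?

  dichotomy-step : ∀ {d} → 1 ≤ d → DichotomyAt d → DichotomyAt (suc d)
  dichotomy-step {d} d≥1 ih {A} {P} A? P? disjunct below with any? (Reduction.R? A? P?)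
  ... | no none = inj₁ λ b a → decidable-stable (HasPrivate? b) (λ ¬pr → none (b , a , ¬pr))
    where open Reduction A? P?
  ... | yes (r₀ , r₀∈R) = inj₂ (reduce bound)
    where
    open Reduction A? P?
    open ≤-Reasoning
    D : ℕ
    D = suc d
    below′ : Below p′ (D ^ 2)
    below′ = below-scale {count P?} {D ^ 2} {p′} {D ^ 2} (s≤s z≤n) (*-monoˡ-≤ (D ^ 2) (count-mono P′? P? (λ _ → proj₁))) below
    bound : count R? + 2 ≤ p′
    -- The threshold is where deletion stops raising the ratio of points to squared parameter: as d²
    -- = D² - 2D + 1, the condition k D² + p′ ≥ 2 D p′ is equivalent to (p′ - k) D² ≤ p′ d².
    bound with any? (λ b → R? b ×-dec ¬? (count (V? b) * D ^ 2 + p′ <? 2 * D * p′))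
    ... | no none = small-blocks disjunct below′ (s≤s z≤n) (r₀ , r₀∈R)
      (λ b r → decidable-stable (_ <? _) (λ large → none (b , r , large)))
    -- Deleting a large block b together with its points leaves a (D - 1)-disjunct family.
    ... | yes (b , r , large) = begin
        count R? + 2                        ≡⟨ cong (_+ 2) (count-remove R? b r) ⟩
        suc (count R∖b?) + 2                ≡⟨ cong suc (+-comm (count R∖b?) 2) ⟩
        -- The k ≥ 3 deleted points pay for the block b and for the surplus 2.
        3 + count R∖b?                      ≤⟨ +-mono-≤ 3≤k (dichotomy⇒≤ R∖b? P″? (ih R∖b? P″? disjunct″ below″)) ⟩
        count (V? b) + count P″?            ≡⟨ count-split P′? (F? b) ⟨
        p′                                  ∎
      where
      R∖b? : ∀ c → Dec (R c × c ≢ b)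
      R∖b? = remove R? b
      P″? : ∀ x → Dec (P′ x × ¬ F b x)
      P″? x = P′? x ×-dec ¬? (F? b x)
      k p″ : ℕ
      k = count (V? b)
      p″ = count P″?
      3≤k : 3 ≤ k
      3≤k = begin
        3              ≤⟨ s≤s (s≤s d≥1) ⟩
        suc D          ≡⟨ cong suc (+-identityʳ D) ⟨
        suc (D + 0)    ≤⟨ matchings-below disjunct r [] ([] , []) ⟩
        k              ∎
      disjunct″ : Disjunct d (λ c → R c × c ≢ b) (λ x → P′ x × ¬ F b x)
      disjunct″ c (rc , c≢b) L len all
        -- With b put on the covering list, the point found lies outside b.
        with x , px , fx , ¬bx ∷ ¬L ← disjunct c (proj₁ rc) (b ∷ L) (s≤s len)
               ((proj₁ r , c≢b ∘ sym) ∷ All.map (λ (((a , _) , _) , ne) → a , ne) all)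
        = x , (private-free rc px fx , ¬bx) , fx , ¬L
      e₁ : ∀ a b s → a * s + b * s ≡ (b + a) * s
      e₁ = solve-∀
      e₂ : ∀ p d → p * (suc d * (suc d * 1)) + p ≡ p * (d * (d * 1)) + 2 * suc d * p
      e₂ = solve-∀
      below″ : Below p″ (d ^ 2)
      below″ = below-scale {p′} {D ^ 2} {p″} {d ^ 2} (*-mono-≤ d≥1 (*-mono-≤ d≥1 ≤-refl)) (+-cancelʳ-≤ (k * D ^ 2 + p′) _ _ (begin
        p″ * D ^ 2 + (k * D ^ 2 + p′)     ≡⟨ +-assoc (p″ * D ^ 2) (k * D ^ 2) p′ ⟨
        p″ * D ^ 2 + k * D ^ 2 + p′       ≡⟨ cong (_+ p′) (e₁ p″ k (D ^ 2)) ⟩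
        (k + p″) * D ^ 2 + p′             ≡⟨ cong (λ c → c * D ^ 2 + p′) (count-split P′? (F? b)) ⟨
        p′ * D ^ 2 + p′                   ≡⟨ e₂ p′ d ⟩
        p′ * d ^ 2 + 2 * D * p′           ≤⟨ +-monoʳ-≤ (p′ * d ^ 2) (≮⇒≥ large) ⟩
        p′ * d ^ 2 + (k * D ^ 2 + p′)     ∎)) below′

  -- The induction starts at d = 1: there p < 1 leaves no points, while disjunctness gives every
  -- block one, so there are no blocks. At d = 0 the bound asks for a number below 0.
  dichotomy : ∀ d → DichotomyAt d
  dichotomy zero A? P? disjunct ()
  dichotomy (suc zero) A? P? disjunct below = inj₁ λ b a →
    let x , px , _ = disjunct b a [] z≤n []
    in ⊥-elim (<-irrefl refl (≤-trans (below⇒< {count P?} {1} below) (count-pos P? x px)))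
  dichotomy (suc (suc d)) = dichotomy-step (s≤s z≤n) (dichotomy (suc d))

-- Frameproof codes

∣p∪q∣≤∣p∣+∣q∣ : ∀ {n} (p q : Subset n) → ∣ p ∪ q ∣ ≤ ∣ p ∣ + ∣ q ∣
∣p∪q∣≤∣p∣+∣q∣ [] [] = z≤n
∣p∪q∣≤∣p∣+∣q∣ (outside ∷ p) (outside ∷ q) = ∣p∪q∣≤∣p∣+∣q∣ p q
∣p∪q∣≤∣p∣+∣q∣ (outside ∷ p) (inside ∷ q) = ≤-trans (s≤s (∣p∪q∣≤∣p∣+∣q∣ p q)) (≤-reflexive (sym (+-suc ∣ p ∣ ∣ q ∣)))
∣p∪q∣≤∣p∣+∣q∣ (inside ∷ p) (outside ∷ q) = s≤s (∣p∪q∣≤∣p∣+∣q∣ p q)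
∣p∪q∣≤∣p∣+∣q∣ (inside ∷ p) (inside ∷ q) = s≤s (≤-trans (∣p∪q∣≤∣p∣+∣q∣ p q) (+-monoʳ-≤ ∣ p ∣ (n≤1+n ∣ q ∣)))

fromList : ∀ {n} → List (Fin n) → Subset n
fromList [] = ∅
fromList (x ∷ L) = ⁅ x ⁆ ∪ fromList L

∣fromList∣≤ : ∀ {n} (L : List (Fin n)) → ∣ fromList L ∣ ≤ length L
∣fromList∣≤ {n} [] = ≤-reflexive (∣⊥∣≡0 n)
∣fromList∣≤ (x ∷ L) = ≤-trans (∣p∪q∣≤∣p∣+∣q∣ ⁅ x ⁆ (fromList L))
  (+-mono-≤ (≤-reflexive (∣⁅x⁆∣≡1 x)) (∣fromList∣≤ L))

∈-fromList⁻ : ∀ {n} {x : Fin n} (L : List (Fin n)) → x ∈ₛ fromList L → x ∈ L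
∈-fromList⁻ [] x∈ = ⊥-elim (∉⊥ x∈)
∈-fromList⁻ (y ∷ L) x∈ with x∈p∪q⁻ ⁅ y ⁆ (fromList L) x∈
... | inj₁ x∈y = here (x∈⁅y⁆⇒x≡y y x∈y)
... | inj₂ x∈L = there (∈-fromList⁻ L x∈L)

third : ∀ {n} → 3 ≤ n → (a b : Fin n) → ∃ λ c → c ≢ a × c ≢ b
third {n} n≥3 a b with any? (λ c → ¬? (c ≟ a) ×-dec ¬? (c ≟ b))
... | yes found = found
... | no none = ⊥-elim (<-irrefl refl (≤-trans n≥3
        (≤-trans (≤-reflexive (sym (count-all (λ c → (c ≟ a) ⊎-dec (c ≟ b)) covered)))
                 (≤-trans (count≤sumOver (λ c → (c ≟ a) ⊎-dec (c ≟ b)) (a ∷ b ∷ [])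
                             (λ { c (inj₁ eq) → here eq ; c (inj₂ eq) → there (here eq) }))
                          (+-mono-≤ (ι≤1 ((a ≟ a) ⊎-dec (a ≟ b))) (+-mono-≤ (ι≤1 ((b ≟ a) ⊎-dec (b ≟ b))) ≤-refl))))))
  where
  covered : ∀ c → c ≡ a ⊎ c ≡ b
  covered c = decidable-stable ((c ≟ a) ⊎-dec (c ≟ b)) (λ ¬ab → none (c , ¬ab ∘ inj₁ , ¬ab ∘ inj₂))

⊤? : ∀ {n} → Fin n → Dec ⊤
⊤? _ = yes tt

count-⊤ : ∀ n → count {n} ⊤? ≡ n
count-⊤ n = count-all ⊤? (λ _ → tt)

injective⇒surjective : ∀ {n} (f : Fin n → Fin n) → (∀ {a b} → f a ≡ f b → a ≡ b) → ∀ r → ∃ λ a → f a ≡ r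
injective⇒surjective {n} f inj r with any? (λ a → f a ≟ r)
... | yes found = found
... | no none = ⊥-elim (<-irrefl refl (begin-strict
    n                             ≡⟨ count-⊤ n ⟨
    count {n} ⊤?                ≤⟨ count≤count ⊤? (remove ⊤? r) (λ a x → x ≟ f a)
                                       (λ a _ → f a , refl) (λ { {a} refl → tt , λ fa≡r → none (a , fa≡r) })
                                       (λ { x≡fa x≡fb → inj (trans (sym x≡fa) x≡fb) }) ⟩
    count (remove ⊤? r)         <⟨ n<1+n _ ⟩
    suc (count (remove ⊤? r))   ≡⟨ count-remove ⊤? r tt ⟨
    count {n} ⊤?                ≡⟨ count-⊤ n ⟩
    n                             ∎))
  where open ≤-Reasoning

permutation-injective : ∀ {q} (π : Permutation′ q) {a b} → π ⟨$⟩ʳ a ≡ π ⟨$⟩ʳ b → a ≡ b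
permutation-injective π eq = trans (sym (inverseˡ π)) (trans (cong (π ⟨$⟩ˡ_) eq) (inverseˡ π))

transpose-left : ∀ {q} (a b : Fin q) → transpose a b ⟨$⟩ʳ a ≡ b
transpose-left a b with a ≟ a
... | yes _ = refl
... | no a≢a = ⊥-elim (a≢a refl)

transpose-fixed : ∀ {q} (a b : Fin q) {c} → c ≢ a → c ≢ b → transpose a b ⟨$⟩ʳ c ≡ c
transpose-fixed a b {c} c≢a c≢b with c ≟ a
... | yes c≡a = ⊥-elim (c≢a c≡a)
... | no _ with c ≟ b
...   | yes c≡b = ⊥-elim (c≢b c≡b)
...   | no _ = refl

-- One transposition brings s to 0 and a second brings the image of a to 1. The second leaves 0
-- alone because that image differs from 0.
send-to-01 : ∀ {q} (s a : Fin (suc (suc q))) → a ≢ s →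
             ∃ λ (π : Permutation′ (suc (suc q))) → π ⟨$⟩ʳ s ≡ zero × π ⟨$⟩ʳ a ≡ suc zero
send-to-01 s a a≢s = π₁ ∘ₚ π₂ , trans (cong (π₂ ⟨$⟩ʳ_) (transpose-left s zero)) (transpose-fixed a′ (suc zero) 0≢a′ (λ ())) ,
                     transpose-left a′ (suc zero)
  where
  π₁ π₂ : Permutation′ _
  a′ : Fin _
  π₁ = transpose s zero
  a′ = π₁ ⟨$⟩ʳ a
  π₂ = transpose a′ (suc zero)
  0≢a′ : zero ≢ a′
  0≢a′ eq = a≢s (permutation-injective π₁ (trans (sym eq) (sym (transpose-left s zero))))

-- Isolating rows and permutation matrices

module _ {q n m : ℕ} (C : Fin m → Word q n) where

  Differs : Fin m → Fin m → Fin n → Set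
  Differs c₀ c i = C c i ≢ C c₀ i

  Differs? : ∀ c₀ c i → Dec (Differs c₀ c i)
  Differs? c₀ c i = ¬? (C c i ≟ C c₀ i)

  -- Apply frameproofness to the coalition c₀ ∷ L: its undetectable positions are those where L agrees with c₀.
  frameproof⇒disjunct : ∀ {d} → WideSenseFP (suc d) C → ∀ c₀ →
                        Families.Disjunct (Differs? c₀) d (_≢ c₀) (λ _ → ⊤)
  frameproof⇒disjunct fp c₀ b b≢c₀ L len others
    with any? (λ i → Differs? c₀ b i ×-dec All.all? (λ c → ¬? (Differs? c₀ c i)) L)
  ... | yes (i , diff , same) = i , tt , diff , same
  ... | no none = ⊥-elim (absurd (∈-fromList⁻ (c₀ ∷ L) (Equivalence.to (fp X (c₀ , c₀∈X) (≤-trans (∣fromList∣≤ (c₀ ∷ L)) (s≤s len)) b) described)))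
    where
    X : Subset m
    X = fromList (c₀ ∷ L)
    ∈-fromList⁺ : ∀ {x} (L : List (Fin m)) → x ∈ L → x ∈ₛ fromList L
    ∈-fromList⁺ (y ∷ L) (here refl) = x∈p∪q⁺ (inj₁ (x∈⁅x⁆ y))
    ∈-fromList⁺ (y ∷ L) (there x∈) = x∈p∪q⁺ (inj₂ (∈-fromList⁺ L x∈))
    c₀∈X : c₀ ∈ₛ X
    c₀∈X = ∈-fromList⁺ (c₀ ∷ L) (here refl)
    described : InWdesc C X (C b)
    described i undet a a∈X = trans
      (decidable-stable (C b i ≟ C c₀ i) (λ diff → none (i , diff ,
        All.tabulate (λ c∈L diff′ → diff′ (undet _ c₀ (∈-fromList⁺ (c₀ ∷ L) (there c∈L)) c₀∈X)))))
      (undet c₀ a c₀∈X a∈X)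
    absurd : ¬ (b ∈ c₀ ∷ L)
    absurd (here b≡c₀) = b≢c₀ b≡c₀
    absurd (there b∈L) = proj₂ (All.lookup others b∈L) refl

  Isolates : Fin n → Fin m → Set
  Isolates r c = ∃ λ s → C c r ≢ s × (∀ j → j ≢ c → C j r ≡ s)

  -- The base word c₀ is any codeword other than c. The remaining n - 1 codewords are too many for
  -- the second alternative, so c has a private row, in which all other codewords agree with c₀.
  frameproof⇒isolated : ∀ {t} → WideSenseFP t C → 3 ≤ t → 3 ≤ m → m ≡ n → BoundHolds t n →
                        ∀ c → ∃ λ r → Isolates r c
  frameproof⇒isolated {suc d} fp _ m≥3 m≡n bound c with c₀ , c₀≢c , _ ← third m≥3 c c
    with Families.dichotomy (Differs? c₀) d (λ b → ¬? (b ≟ c₀)) ⊤?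
           (frameproof⇒disjunct fp c₀) (subst (λ p → Below p (d ^ 2)) (sym (count-⊤ n)) bound)
  ... | inj₁ private′ with r , (_ , diff) , own ← private′ c (c₀≢c ∘ sym)
    = r , C c₀ r , diff , λ j j≢c → decidable-stable (C j r ≟ C c₀ r)
        (λ diff′ → j≢c (own j (λ { refl → diff′ refl }) diff′))
  ... | inj₂ few = ⊥-elim (<-irrefl refl (begin-strict
      m                                       ≡⟨ blocks ⟩
      suc (count (λ b → ¬? (b ≟ c₀)))         <⟨ ≤-reflexive (+-comm 2 _) ⟩
      count (λ b → ¬? (b ≟ c₀)) + 2           ≤⟨ few ⟩
      count {n} ⊤?                            ≡⟨ count-⊤ n ⟩
      n                                       ≡⟨ m≡n ⟨
      m                                       ∎))
    where
    open ≤-Reasoning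
    blocks : m ≡ suc (count (λ b → ¬? (b ≟ c₀)))
    blocks = trans (sym (count-⊤ m)) (count-remove ⊤? c₀ tt)

-- Different codewords have different isolating rows, so by pigeonhole the choice `ρ` of rows is a
-- bijection with inverse `γ`. In each row the common symbol is relabelled 0 and the exceptional one
-- 1.
isolated⇒standardForm : ∀ {q n} (C : Fin n → Word (suc (suc q)) n) → 3 ≤ n →
                        (∀ c → ∃ λ r → Isolates C r c) → StdFormIsPermMatrix C
isolated⇒standardForm {q} {n} C n≥3 isolated = σ , standard , refl , ≤1 , row-one , column-one
  where
  ρ : Fin n → Fin n
  ρ c = proj₁ (isolated c)
  isolates-unique : ∀ {r c c′} → Isolates C r c → Isolates C r c′ → c ≡ c′
  -- A third column e forces s = s′, and then c itself, having symbol s′, would have symbol s.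
  isolates-unique {r} {c} {c′} (s , c≢s , rest) (s′ , _ , rest′) = decidable-stable (c ≟ c′) λ c≢c′ →
    let e , e≢c , e≢c′ = third n≥3 c c′
    in c≢s (trans (rest′ c c≢c′) (trans (sym (rest′ e e≢c′)) (rest e e≢c)))
  ρ-injective : ∀ {a b} → ρ a ≡ ρ b → a ≡ b
  ρ-injective {a} {b} eq = isolates-unique (subst (λ r → Isolates C r a) eq (proj₂ (isolated a))) (proj₂ (isolated b))
  γ : Fin n → Fin n
  γ r = proj₁ (injective⇒surjective ρ ρ-injective r)
  ρ-γ : ∀ r → ρ (γ r) ≡ r
  ρ-γ r = proj₂ (injective⇒surjective ρ ρ-injective r)
  γ-isolated : ∀ r → Isolates C r (γ r)
  γ-isolated r = subst (λ r′ → Isolates C r′ (γ r)) (ρ-γ r) (proj₂ (isolated (γ r)))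
  relabel : ∀ r → ∃ λ π → π ⟨$⟩ʳ proj₁ (γ-isolated r) ≡ zero × π ⟨$⟩ʳ C (γ r) r ≡ suc zero
  relabel r = send-to-01 (proj₁ (γ-isolated r)) (C (γ r) r) (proj₁ (proj₂ (γ-isolated r)))
  σ : Fin n → Permutation′ (suc (suc q))
  σ r = proj₁ (relabel r)
  M : Fin n → Fin n → Fin (suc (suc q))
  M = permuteRows σ (RepMatrix C)
  M-one : ∀ r → M r (γ r) ≡ suc zero
  M-one r = proj₂ (proj₂ (relabel r))
  M-zero : ∀ r j → j ≢ γ r → M r j ≡ zero
  M-zero r j j≢ = trans (cong (σ r ⟨$⟩ʳ_) (proj₂ (proj₂ (γ-isolated r)) j j≢)) (proj₁ (proj₂ (relabel r)))
  ≤1 : ∀ r j → toℕ (M r j) ≤ 1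
  ≤1 r j with j ≟ γ r
  ... | yes refl = ≤-reflexive (cong toℕ (M-one r))
  ... | no j≢ = ≤-trans (≤-reflexive (cong toℕ (M-zero r j j≢))) z≤n
  positive⇒γ : ∀ r j → 1 ≤ toℕ (M r j) → j ≡ γ r
  positive⇒γ r j pos = decidable-stable (j ≟ γ r) λ j≢ → <-irrefl refl (≤-trans pos (≤-reflexive (cong toℕ (M-zero r j j≢))))
  row-one : ∀ r → Σ (Fin n) λ j → toℕ (M r j) ≡ 1 × (∀ j′ → toℕ (M r j′) ≡ 1 → j′ ≡ j)
  row-one r = γ r , cong toℕ (M-one r) , λ j′ one → positive⇒γ r j′ (≤-reflexive (sym one))
  column-one : ∀ j → Σ (Fin n) λ r → toℕ (M r j) ≡ 1 × (∀ r′ → toℕ (M r′ j) ≡ 1 → r′ ≡ r)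
  column-one j = ρ j , trans (cong (toℕ ∘ M (ρ j)) (sym (ρ-injective (ρ-γ (ρ j))))) (cong toℕ (M-one (ρ j))) ,
    λ r′ one → trans (sym (ρ-γ r′)) (cong ρ (sym (positive⇒γ r′ j (≤-reflexive (sym one)))))
  rowCount≡ : ∀ r i → rowCount M r i ≡ count (λ j → M r j ≟ i)
  rowCount≡ r i = length-filter-tabulate (λ j → M r j ≟ i) id
  standard : StandardForm M
  standard r i k i≤k = ≤-trans (≤-reflexive (rowCount≡ r k)) (≤-trans (antitone i k i≤k) (≤-reflexive (sym (rowCount≡ r i))))
    where
    -- In each row 0 occurs at least once, 1 at most once, and larger symbols never.
    antitone : ∀ i k → toℕ i ≤ toℕ k → count (λ j → M r j ≟ k) ≤ count (λ j → M r j ≟ i)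
    antitone zero zero _ = ≤-refl
    antitone zero (suc k) _ = ≤-trans
      (count≤ι (λ j → M r j ≟ suc k) (yes tt)
        (λ a b a≡ b≡ → trans (at-γ a≡) (sym (at-γ b≡))) (λ _ _ → tt))
      (let j , j≢ , _ = third n≥3 (γ r) (γ r) in count-pos (λ j → M r j ≟ zero) j (M-zero r j j≢))
      where
      at-γ : ∀ {j} → M r j ≡ suc k → j ≡ γ r
      at-γ {j} eq = positive⇒γ r j (≤-trans (s≤s z≤n) (≤-reflexive (cong toℕ (sym eq))))
    antitone (suc zero) (suc zero) _ = ≤-refl
    antitone (suc (suc _)) (suc zero) (s≤s ())
    antitone (suc i) (suc (suc k)) _ = ≤-trans (≤-reflexive (count-none (λ j → M r j ≟ suc (suc k)) (λ j eq →
      <-irrefl refl (≤-trans (s≤s (s≤s z≤n)) (≤-trans (≤-reflexive (cong toℕ (sym eq))) (≤1 r j)))))) z≤n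

-- For j outside X, take the row where column j has its 1. All columns of X have 0 there, so the row
-- is undetectable for X, and a description of column j by X would require a 1 in a column of X.
permutationMatrix⇒frameproof : ∀ {q n m} t (C : Fin m → Word q n) (σ : Fin n → Permutation′ q) →
                               IsPermutationMatrix (permuteRows σ (RepMatrix C)) → WideSenseFP t C
permutationMatrix⇒frameproof {q} {n} {m} t C σ (_ , ≤1 , rows , columns) X (x , x∈X) _ j =
  mk⇔ framed (λ j∈X i undet a a∈X → undet j a j∈X a∈X)
  where
  framed : InWdesc C X (C j) → j ∈ₛ X
  framed desc with j ∈ₛ? X
  ... | yes j∈X = j∈X
  ... | no j∉X = ⊥-elim (j∉X (subst (_∈ₛ X) x≡j x∈X))
    where
    r : Fin n
    r = proj₁ (columns j)
    M : Fin m → Fin q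
    M = permuteRows σ (RepMatrix C) r
    one : toℕ (M j) ≡ 1
    one = proj₁ (proj₂ (columns j))
    one-unique : ∀ a → toℕ (M a) ≡ 1 → a ≡ j
    one-unique a eq = trans (proj₂ (proj₂ (rows r)) a eq) (sym (proj₂ (proj₂ (rows r)) j one))
    M≡0 : ∀ {a} → a ∈ₛ X → toℕ (M a) ≡ 0
    M≡0 {a} a∈X = n<1⇒n≡0 (≤∧≢⇒< (≤1 r a) (λ eq → j∉X (subst (_∈ₛ X) (one-unique a eq) a∈X)))
    undetectable : Undetectable C X r
    undetectable a b a∈X b∈X = permutation-injective (σ r) (toℕ-injective (trans (M≡0 a∈X) (sym (M≡0 b∈X))))
    x≡j : x ≡ j
    x≡j = one-unique x (trans (cong (toℕ ∘ (σ r ⟨$⟩ʳ_)) (sym (desc r undetectable x x∈X))) one)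

theorem1p14 : (q t n : ℕ) → 2 ≤ q → 3 ≤ t → 3 ≤ n → BoundHolds t n →
    (m : ℕ) (C : Fin m → Word q n) → Injective _≡_ _≡_ C →
    ((WideSenseFP t C × m ≡ n) ⇔ StdFormIsPermMatrix C)
theorem1p14 (suc zero) _ _ (s≤s ())
theorem1p14 (suc (suc q)) t n _ t≥3 n≥3 bound m C _ = mk⇔
  (λ { (fp , refl) → isolated⇒standardForm C n≥3 (frameproof⇒isolated C fp t≥3 n≥3 refl bound) })
  (λ { (σ , _ , perm) → permutationMatrix⇒frameproof t C σ perm , proj₁ perm })
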